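{- For the directed cycles $\overrightarrow{C_n}$, $n\ge2$, $$\sum_{n\ge2}X_{\overrightarrow{C_n}}(\mathbf{x},t)\,z^n=\frac{t\displaystyle\sum_{k\ge2}k\,[k-1]_t\,e_k\,z^k}{1-t\displaystyle\sum_{k\ge2}[k-1]_t\,e_k\,z^k},$$ where $[k]_t=1+t+\cdots+t^{k-1}$. Consequently, $X_{\overrightarrow{C_n}}(\mathbf{x},t)$ is palindromic, $e$-positive, and $e$-unimodal.
   Context: $\overrightarrow{C_n}$ is the cycle on $n$ vertices oriented cyclically, with directed edges $1\to2\to\cdots\to n\to1$ (for $n=2$: the two directed edges $1\to2$ and $2\to1$). For a digraph $\overrightarrow{G}=(V,E)$, a proper coloring is a map $\kappa:V\to\mathbb{P}=\{1,2,3,\dots\}$ with $\kappa(u)\ne\kappa(v)$ whenever $u,v$ are adjacent, $\mathrm{asc}(\kappa)=|\{(u,v)\in E:\kappa(u)<\kappa(v)\}|$ (where $(u,v)$ is directed from $u$ to $v$), and $$X_{\overrightarrow{G}}(\mathbf{x},t)=\sum_{\kappa}t^{\mathrm{asc}(\kappa)}\prod_{v\in V}x_{\kappa(v)},$$ summed over all proper colorings. $e_k$ is the $k$th elementary symmetric function in $x_1,x_2,\dots$, and $e_\lambda=e_{\lambda_1}e_{\lambda_2}\cdots$. The identity is one of formal power series in $z$. Let $m$ be the number of directed edges (here $m=n$) and write $X_{\overrightarrow{G}}(\mathbf{x},t)=\sum_{j=0}^m a_j(\mathbf{x})t^j$. Palindromic means $a_j=a_{m-j}$ for all $j$. A symmetric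 function is $e$-positive if its expansion in the basis $\{e_\lambda\}$ has nonnegative coefficients; $X_{\overrightarrow{G}}(\mathbf{x},t)$ is $e$-positive if every $a_j$ is, and it is $e$-unimodal if $a_{j+1}(\mathbf{x})-a_j(\mathbf{x})$ is $e$-positive for all $0\le j<\frac{m-1}{2}$. -}

module Defs where

open import Algebra.Bundles using (RawRing)
import Algebra.Definitions.RawSemiring as RawSemiringDefs
open import Data.Bool using (if_then_else_)
open import Data.Fin as Fin using (Fin; toℕ)
open import Data.Integer as ℤ using (ℤ; +_; 0ℤ; 1ℤ)
open import Data.List as List using (List; []; _∷_; length; filter; foldr; map; cartesianProductWith; allFin)
open import Data.List.Properties using (≡-dec)
open import Data.List.Relation.Unary.All using (All; all?)
open import Data.List.Relation.Unary.Linked using (Linked)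
open import Data.List.Relation.Unary.Unique.Propositional using (Unique)
open import Data.List.Relation.Unary.Unique.Propositional.Properties using (tabulate⁺)
open import Data.Nat as ℕ using (ℕ; zero; suc; _∸_; _≤_; _<_; _≥_; _≤?_; _≟_)
open import Data.Nat.ListAction using (sum)
open import Data.Nat.DivMod using (_mod_)
open import Data.Product using (_×_; _,_; proj₁; proj₂; ∃)
open import Data.Vec as Vec using (Vec; lookup)
open import Level using (0ℓ)
open import Relation.Binary.PropositionalEquality using (_≡_; _≢_; cong)
open import Relation.Nullary using (Dec; does; ¬?; _×-dec_)

------------------------------------------------------------------------
-- Formal power series in one variable over R; f n is the nth coefficient.

module PowerSeries {r ℓ} (R : RawRing r ℓ) where
  private
    module R where
      open RawRing R public
      open RawSemiringDefs rawSemiring public using (sum)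

  Series : Set r
  Series = ℕ → R.Carrier

  const : R.Carrier → Series
  const x zero    = x
  const x (suc _) = R.0#

  var : Series
  var 1 = R.1#
  var _ = R.0#

  -- Σ_{k ≥ 2} c k · (variable)ᵏ
  Σ≥2 : (ℕ → R.Carrier) → Series
  Σ≥2 c 0 = R.0#
  Σ≥2 c 1 = R.0#
  Σ≥2 c k = c k

  rawRing : RawRing r ℓ
  rawRing = record
    { Carrier = Series
    ; _≈_     = λ f g → ∀ n → f n R.≈ g n
    ; _+_     = λ f g n → f n R.+ g n
    ; _*_     = λ f g n → R.sum {suc n} λ i → f (toℕ i) R.* g (n ∸ toℕ i)
    ; -_      = λ f n → R.- f n
    ; 0#      = λ _ → R.0#
    ; 1#      = const R.1#
    }

------------------------------------------------------------------------
-- Formal power series over ℤ in x₁, x₂, …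

-- The exponent list a₁ ∷ … ∷ a_N ∷ [] stands for x₁^a₁ ⋯ x_N^a_N, so lists
-- differing by trailing zeros denote the same monomial.  A function on lists
-- records the coefficients of f(x₁, …, x_N, 0, 0, …) for every N.
Monomial : Set
Monomial = List ℕ

ℤ⟦x⟧ : RawRing 0ℓ 0ℓ
ℤ⟦x⟧ = record
  { Carrier = Monomial → ℤ
  ; _≈_     = λ f g → ∀ α → f α ≡ g α
  ; _+_     = λ f g α → f α ℤ.+ g α
  ; _*_     = mul
  ; -_      = λ f α → ℤ.- f α
  ; 0#      = λ _ → 0ℤ
  ; 1#      = λ α → if does (sum α ≟ 0) then 1ℤ else 0ℤ
  }
  where
  open RawSemiringDefs (RawRing.rawSemiring ℤ.+-*-rawRing) using () renaming (sum to ∑)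

  -- Cauchy product, one variable at a time.
  mul : (f g : Monomial → ℤ) → Monomial → ℤ
  mul f g []      = f [] ℤ.* g []
  mul f g (a ∷ α) =
    ∑ {suc a} λ i → mul (λ β → f (toℕ i ∷ β)) (λ β → g ((a ∸ toℕ i) ∷ β)) α

module X = RawRing ℤ⟦x⟧

module T-series = PowerSeries ℤ⟦x⟧

ℤ⟦x⟧⟦t⟧ : RawRing 0ℓ 0ℓ
ℤ⟦x⟧⟦t⟧ = T-series.rawRing

module T where
  open RawRing ℤ⟦x⟧⟦t⟧ public
  open RawSemiringDefs rawSemiring public using (sum; _^_) renaming (_×_ to _·_)

module Z-series = PowerSeries ℤ⟦x⟧⟦t⟧

ℤ⟦x⟧⟦t⟧⟦z⟧ : RawRing 0ℓ 0ℓ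
ℤ⟦x⟧⟦t⟧⟦z⟧ = Z-series.rawRing

module Z = RawRing ℤ⟦x⟧⟦t⟧⟦z⟧

t : T.Carrier
t = T-series.var

[_]ₜ : ℕ → T.Carrier
[ k ]ₜ = T.sum {k} λ i → t T.^ toℕ i

-- f ≈ A / B: the denominator is invertible and f is A times its inverse.
_≈_/_ : (f A B : Z.Carrier) → Set
f ≈ A / B = ∃ λ B⁻¹ → (B Z.* B⁻¹ Z.≈ Z.1#) × (f Z.≈ A Z.* B⁻¹)

------------------------------------------------------------------------
-- Elementary symmetric functions and e-positivity

-- The sum of all squarefree monomials of degree k.
e : ℕ → X.Carrier
e k α = if does (all? (_≤? 1) α ×-dec sum α ≟ k) then 1ℤ else 0ℤ

IsPartition : List ℕ → Set
IsPartition μ = All (0 <_) μ × Linked _≥_ μ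

e[_] : List ℕ → X.Carrier
e[ μ ] = foldr (λ k f → e k X.* f) X.1# μ

-- Σ c_μ e_μ over a finite list of pairs (c_μ , μ).
e-combination : List (ℤ × List ℕ) → X.Carrier
e-combination = foldr (λ (c , μ) f → (λ α → c ℤ.* e[ μ ] α) X.+ f) X.0#

record IsEExpansion (f : X.Carrier) (terms : List (ℤ × List ℕ)) : Set where
  field
    partitions : All (λ (_ , μ) → IsPartition μ) terms
    distinct   : Unique (map proj₂ terms)
    expansion  : f X.≈ e-combination terms

EPositive : X.Carrier → Set
EPositive f = ∃ λ terms → IsEExpansion f terms × All (λ (c , _) → 0ℤ ℤ.≤ c) terms

------------------------------------------------------------------------
-- Digraphs and their chromatic quasisymmetric functions

record Digraph : Set where
  field
    order  : ℕ
    edges  : List (Fin order × Fin order)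
    unique : Unique edges

  size : ℕ
  size = length edges

open Digraph public

next : ∀ {n} → Fin n → Fin n
next {suc n} i = suc (toℕ i) mod suc n

-- Vertex i + 1 of the cycle is represented by i.
cycle : ℕ → Digraph
cycle n = record
  { order  = n
  ; edges  = List.tabulate {n = n} λ i → i , next i
  ; unique = tabulate⁺ (cong proj₁)
  }

-- Colourings of n vertices by the first N colours.
Colouring : ℕ → ℕ → Set
Colouring N n = Vec (Fin N) n

colourings : ∀ N n → List (Colouring N n)
colourings N zero    = Vec.[] ∷ []
colourings N (suc n) = cartesianProductWith Vec._∷_ (allFin N) (colourings N n)

module _ (G : Digraph) {N : ℕ} (κ : Colouring N (order G)) where

  Proper : Set
  Proper = All (λ (u , v) → lookup κ u ≢ lookup κ v) (edges G)

  proper? : Dec Proper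
  proper? = all? (λ (u , v) → ¬? (lookup κ u Fin.≟ lookup κ v)) (edges G)

  asc : ℕ
  asc = length (filter (λ (u , v) → lookup κ u Fin.<? lookup κ v) (edges G))

-- The exponents of ∏_v x_{κ(v)}.
content : ∀ {N n} → Colouring N n → Monomial
content {N} κ = List.tabulate {n = N} λ c → Vec.count (c Fin.≟_) κ

-- The coefficient of tʲ xᵅ is the number of proper κ with asc κ = j and
-- ∏_v x_{κ(v)} = xᵅ; such a κ only uses the first (length α) colours.
chromatic : Digraph → T.Carrier
chromatic G j α = + length (filter contributes? (colourings (length α) (order G)))
  where
  contributes? : (κ : Colouring (length α) (order G)) →
                 Dec (Proper G κ × asc G κ ≡ j × content κ ≡ α)
  contributes? κ = proper? G κ ×-dec asc G κ ≟ j ×-dec ≡-dec _≟_ (content κ) α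

-- Below, m is the number of edges and a j the coefficient of tʲ.
module _ (G : Digraph) where
  private
    m = size G
    a = chromatic G

  ChromaticPalindromic : Set
  ChromaticPalindromic = ∀ j → j ≤ m → a j X.≈ a (m ∸ j)

  ChromaticEPositive : Set
  ChromaticEPositive = ∀ j → EPositive (a j)

  -- 2 * j < m ∸ 1 is j < (m - 1) / 2 over the rationals.
  ChromaticEUnimodal : Set
  ChromaticEUnimodal = ∀ j → 2 ℕ.* j < m ∸ 1 → EPositive (a (suc j) X.+ X.- a j)

{-# OPTIONS --safe #-}
-- In N colours, a proper colouring of the directed n-cycle is a closed walk of
-- length n for the matrix M with entries w(i,k) x_k, where w is t, 0 or 1 for
-- i < k, i = k, i > k, so its generating function is tr (Mⁿ).  The determinant
-- P = det (1 − z M) is 1 − t Σ_{k≥2} [k−1]_t e_k zᵏ, and an explicit row vector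
-- shows P (x) · (1 − z M)⁻¹_{00} = P (x without x₀).  Moving the smallest colour
-- to the top conjugates M by diag (t, 1, …, 1), so the same holds for every
-- diagonal entry (1 − z M)⁻¹_{jj}; summing over j gives the identity.
--
-- The identity is a recurrence X_n = t n [n−1]_t e_n + Σ_k t [k−1]_t e_k X_{n−k},
-- so X_n is a sum of terms tᵃ [b]_t e_μ with 2a + b = n + 1: multiplication by
-- [c]_t preserves this shape because [c+1][b+1] = [b+c+1] + t [c][b].
module Submission where

open import Algebra.Bundles using (CommutativeRing; RawRing)
import Algebra.Consequences.Setoid as Consequences
import Algebra.Definitions.RawSemiring as RawSemiringDefs
import Algebra.Morphism.RingMonomorphism as RingMonomorphism
open import Algebra.Morphism.Structures using (IsRingMonomorphism)
import Algebra.Properties.AbelianGroup as AbelianGroupProperties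
import Algebra.Properties.CommutativeMonoid.Mult as CommutativeMonoidMult
import Algebra.Properties.CommutativeMonoid.Sum as CommutativeMonoidSum
import Algebra.Properties.Group as GroupProperties
import Algebra.Properties.Monoid.Sum as MonoidSum
import Algebra.Properties.Ring as RingProperties
import Algebra.Properties.Semiring.Mult as SemiringMult
import Algebra.Properties.Semiring.Sum as SemiringSum
import Algebra.Solver.Ring.NaturalCoefficients.Default as SemiringSolver
open import Algebra.Structures using (IsCommutativeRing)
open import Data.Bool using (Bool; true; false; if_then_else_; _∧_)
open import Data.Fin as Fin using (Fin; zero; suc; inject₁; fromℕ; toℕ)
open import Data.Fin.Properties using (toℕ-inject₁; toℕ-fromℕ; toℕ-fromℕ<; toℕ-injective; toℕ<n)
open import Data.Integer as ℤ using (ℤ; +_; 0ℤ; 1ℤ)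
import Data.Integer.Properties as ℤₚ
open import Data.Integer.Tactic.RingSolver using () renaming (solve-∀ to solve-∀ℤ)
open import Data.List using (List; []; _∷_; _++_; map; foldr; length; filter; tabulate; cartesianProductWith; allFin)
open import Data.List.Properties using (≡-dec; length-tabulate)
import Data.List.Relation.Binary.Permutation.Propositional as ↭
open import Data.List.Relation.Binary.Permutation.Propositional.Properties using (All-resp-↭)
open import Data.List.Relation.Unary.All using (All; []; _∷_; all?)
open import Data.List.Relation.Unary.AllPairs using ([]; _∷_)
open import Data.List.Relation.Unary.Unique.Propositional using (Unique)
import Data.List.Sort as Sort
open import Data.Nat as ℕ using (ℕ; zero; suc; _∸_; _≤_; _<_; _≟_; _≤?_; z≤n; s≤s)
open import Data.Nat.DivMod using (m<n⇒m%n≡m; n%n≡0)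
open import Data.Nat.Induction using (<-rec)
open import Data.Nat.Properties as ℕₚ using (≤-refl; ≤-trans; n≤1+n; suc-injective)
open import Data.Nat.Tactic.RingSolver using () renaming (solve-∀ to solve-∀ℕ)
open import Data.Product using (_×_; _,_; proj₁; proj₂; ∃)
open import Data.Vec as Vec using (Vec; []; _∷_; lookup)
open import Data.Vec.Functional using (Vector; removeAt; tail)
open import Function using (_∘_; id)
open import Level using (0ℓ; _⊔_)
import Relation.Binary.Construct.Flip.EqAndOrd as Flip
import Relation.Binary.Reasoning.Setoid as SetoidReasoning
open import Relation.Binary.PropositionalEquality as ≡ using (_≡_; _≢_)
open import Relation.Binary.Bundles using (Setoid)
open import Relation.Binary.Structures using (IsEquivalence)
open import Relation.Nullary using (Dec; does; ¬?; _×-dec_; yes; no; contradiction)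
open import Relation.Unary using (Decidable)
open import Defs

-- Power series over a commutative ring

-- A coefficient at `α` involves only `length α` variables, and `chromatic` reads it off from
-- colourings by exactly `length α` colours. The identity is therefore proved in a separate ring
-- `Ring[ N ]` for each number `N` of colours, and the laws of the full ring are collected from
-- these rings in the same way. No matrix, determinant or quotient is formed: `M` acts on vectors by
-- recursion over the colours, `P` is a recursively defined polynomial, and the inverse of 1 - zM is
-- the series that enumerates walks. The recursion singles out the smallest colour, so only the
-- (0,0) entry is directly accessible; this is what makes the rotation necessary. As t is not
-- invertible, the conjugation becomes a relation between vectors. Once the empty walk is removed,
-- colour j contributes t [m]_t x_j e_m (x without x_j) to the numerator at z^(m+1). Summed over j,
-- a squarefree monomial of degree k occurs once for each of its k variables, whence the factor k.

module PowerSeriesProperties {r ℓ} (R : CommutativeRing r ℓ) where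
  open CommutativeRing R hiding (zero)

  open PowerSeries rawRing public
  open RawRing (PowerSeries.rawRing (CommutativeRing.rawRing R)) public
    using () renaming (_≈_ to _≋_; _+_ to _⊕_; _*_ to _⊛_; -_ to ⊖_; 0# to 𝟘; 1# to 𝟙)
  open SetoidReasoning setoid
  open SemiringSolver commutativeSemiring using (solve; _:+_; _:*_; _:=_)

  -- The sum in the Cauchy product peels its first index by computation, so `(f ⊛ g) (suc n)`
  -- unfolds to `f 0 * g (suc n) + (shift f ⊛ g) n`. The ring laws are inductions along this
  -- recursion.
  shift : Series → Series
  shift f n = f (suc n)

  ⊛-cong : ∀ {f f′ g g′} → f ≋ f′ → g ≋ g′ → f ⊛ g ≋ f′ ⊛ g′
  ⊛-cong p q zero    = +-congʳ (*-cong (p 0) (q 0))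
  ⊛-cong p q (suc n) = +-cong (*-cong (p 0) (q (suc n))) (⊛-cong (λ i → p (suc i)) q n)

  -- Makes the equation for an inverse series contracting: the coefficient at `suc n` is determined
  -- by those of index at most `n`.
  ⊛-local : ∀ f {g h} n → (∀ i → i ≤ n → g i ≈ h i) → (f ⊛ g) n ≈ (f ⊛ h) n
  ⊛-local f zero    p = +-congʳ (*-congˡ (p 0 z≤n))
  ⊛-local f (suc n) p = +-cong (*-congˡ (p (suc n) (s≤s ≤-refl))) (⊛-local (shift f) n λ i i≤n → p i (≤-trans i≤n (n≤1+n n)))

  𝟘-⊛ : ∀ f → 𝟘 ⊛ f ≋ 𝟘
  𝟘-⊛ f zero    = trans (+-identityʳ _) (zeroˡ _)
  𝟘-⊛ f (suc n) = trans (+-cong (zeroˡ _) (𝟘-⊛ f n)) (+-identityˡ _)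

  const-⊛ : ∀ x f n → (const x ⊛ f) n ≈ x * f n
  const-⊛ x f zero    = +-identityʳ _
  const-⊛ x f (suc n) = trans (+-congˡ (𝟘-⊛ f n)) (+-identityʳ _)

  ⊛-scale : ∀ x f g n → ((λ i → x * f i) ⊛ g) n ≈ x * (f ⊛ g) n
  ⊛-scale x f g zero    = trans (+-identityʳ _) (trans (*-assoc _ _ _) (*-congˡ (sym (+-identityʳ _))))
  ⊛-scale x f g (suc n) = begin
    x * f 0 * g (suc n) + ((λ i → x * f (suc i)) ⊛ g) n ≈⟨ +-cong (*-assoc _ _ _) (⊛-scale x (shift f) g n) ⟩
    x * (f 0 * g (suc n)) + x * (shift f ⊛ g) n         ≈⟨ distribˡ _ _ _ ⟨
    x * (f 0 * g (suc n) + (shift f ⊛ g) n)             ∎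

  ⊛-distribʳ : ∀ h f g → (f ⊕ g) ⊛ h ≋ (f ⊛ h) ⊕ (g ⊛ h)
  ⊛-distribʳ h f g zero = begin
    (f 0 + g 0) * h 0 + 0#              ≈⟨ +-cong (distribʳ _ _ _) (sym (+-identityʳ _)) ⟩
    f 0 * h 0 + g 0 * h 0 + (0# + 0#)   ≈⟨ solve 4 (λ a b c d → a :+ b :+ (c :+ d) := a :+ c :+ (b :+ d)) refl _ _ _ _ ⟩
    (f 0 * h 0 + 0#) + (g 0 * h 0 + 0#) ∎
  ⊛-distribʳ h f g (suc n) = begin
    (f 0 + g 0) * h (suc n) + ((shift f ⊕ shift g) ⊛ h) n
      ≈⟨ +-congˡ (⊛-distribʳ h (shift f) (shift g) n) ⟩
    (f 0 + g 0) * h (suc n) + ((shift f ⊛ h) n + (shift g ⊛ h) n)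
      ≈⟨ solve 5 (λ a b c d e → (a :+ b) :* c :+ (d :+ e) := (a :* c :+ d) :+ (b :* c :+ e)) refl _ _ _ _ _ ⟩
    (f 0 * h (suc n) + (shift f ⊛ h) n) + (g 0 * h (suc n) + (shift g ⊛ h) n) ∎

  -- Peels the last summand instead of the first; commutativity exchanges the two ways of peeling.
  ⊛-sucʳ : ∀ f g n → (f ⊛ g) (suc n) ≈ (f ⊛ shift g) n + f (suc n) * g 0
  ⊛-sucʳ f g zero = begin
    f 0 * g 1 + (f 1 * g 0 + 0#) ≈⟨ solve 3 (λ a b c → a :+ (b :+ c) := a :+ c :+ b) refl _ _ _ ⟩
    f 0 * g 1 + 0# + f 1 * g 0   ∎
  ⊛-sucʳ f g (suc n) = trans (+-congˡ (⊛-sucʳ (shift f) g n)) (sym (+-assoc _ _ _))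

  ⊛-comm : ∀ f g → f ⊛ g ≋ g ⊛ f
  ⊛-comm f g zero    = +-congʳ (*-comm _ _)
  ⊛-comm f g (suc n) = begin
    f 0 * g (suc n) + (shift f ⊛ g) n ≈⟨ +-cong (*-comm _ _) (⊛-comm (shift f) g n) ⟩
    g (suc n) * f 0 + (g ⊛ shift f) n ≈⟨ +-comm _ _ ⟩
    (g ⊛ shift f) n + g (suc n) * f 0 ≈⟨ ⊛-sucʳ g f n ⟨
    (g ⊛ f) (suc n)                   ∎

  ⊛-assoc : ∀ f g h → (f ⊛ g) ⊛ h ≋ f ⊛ (g ⊛ h)
  ⊛-assoc f g h zero = begin
    (f 0 * g 0 + 0#) * h 0 + 0# ≈⟨ +-congʳ (trans (*-congʳ (+-identityʳ _)) (*-assoc _ _ _)) ⟩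
    f 0 * (g 0 * h 0) + 0#      ≈⟨ +-congʳ (*-congˡ (+-identityʳ _)) ⟨
    f 0 * (g 0 * h 0 + 0#) + 0# ∎
  ⊛-assoc f g h (suc n) = begin
    (f 0 * g 0 + 0#) * h (suc n) + (((λ i → f 0 * g (suc i)) ⊕ (shift f ⊛ g)) ⊛ h) n
      ≈⟨ +-cong (*-congʳ (+-identityʳ _)) (⊛-distribʳ h (λ i → f 0 * g (suc i)) (shift f ⊛ g) n) ⟩
    f 0 * g 0 * h (suc n) + (((λ i → f 0 * g (suc i)) ⊛ h) n + ((shift f ⊛ g) ⊛ h) n)
      ≈⟨ +-congˡ (+-cong (⊛-scale (f 0) (shift g) h n) (⊛-assoc (shift f) g h n)) ⟩
    f 0 * g 0 * h (suc n) + (f 0 * (shift g ⊛ h) n + (shift f ⊛ (g ⊛ h)) n)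
      ≈⟨ solve 5 (λ a b c d e → a :* b :* c :+ (a :* d :+ e) := a :* (b :* c :+ d) :+ e) refl _ _ _ _ _ ⟩
    f 0 * (g 0 * h (suc n) + (shift g ⊛ h) n) + (shift f ⊛ (g ⊛ h)) n ∎

  series-isCommutativeRing : IsCommutativeRing _≋_ _⊕_ _⊛_ ⊖_ 𝟘 𝟙
  series-isCommutativeRing = record
    { isRing = record
      { +-isAbelianGroup = record
        { isGroup = record
          { isMonoid = record
            { isSemigroup = record
              { isMagma = record
                { isEquivalence = ≋-equiv
                ; ∙-cong = λ p q n → +-cong (p n) (q n) }
              ; assoc = λ f g h n → +-assoc (f n) (g n) (h n) }
            ; identity = (λ f n → +-identityˡ (f n)) , (λ f n → +-identityʳ (f n)) }
          ; inverse = (λ f n → -‿inverseˡ (f n)) , (λ f n → -‿inverseʳ (f n))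
          ; ⁻¹-cong = λ p n → -‿cong (p n) }
        ; comm = λ f g n → +-comm (f n) (g n) }
      ; *-cong = ⊛-cong
      ; *-assoc = ⊛-assoc
      ; *-identity = comm∧idˡ⇒id ⊛-comm λ f n → trans (const-⊛ 1# f n) (*-identityˡ (f n))
      ; distrib = comm∧distrʳ⇒distr (λ p q n → +-cong (p n) (q n)) ⊛-comm ⊛-distribʳ
      }
    ; *-comm = ⊛-comm
    }
    where
    ≋-equiv : IsEquivalence _≋_
    ≋-equiv = record { refl = λ _ → refl ; sym = λ p n → sym (p n) ; trans = λ p q n → trans (p n) (q n) }
    ≋-setoid : Setoid r ℓ
    ≋-setoid = record { isEquivalence = ≋-equiv }
    open Consequences ≋-setoid

  commutativeRing : CommutativeRing r ℓ
  commutativeRing = record { isCommutativeRing = series-isCommutativeRing }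

  var-⊛-zero : ∀ f → (var ⊛ f) 0 ≈ 0#
  var-⊛-zero f = trans (+-identityʳ _) (zeroˡ _)

  var-⊛-suc : ∀ f n → (var ⊛ f) (suc n) ≈ f n
  var-⊛-suc f n = begin
    0# * f (suc n) + (shift var ⊛ f) n ≈⟨ +-cong (zeroˡ _) (⊛-cong shift-var (λ i → refl {f i}) n) ⟩
    0# + (const 1# ⊛ f) n              ≈⟨ +-identityˡ _ ⟩
    (const 1# ⊛ f) n                   ≈⟨ const-⊛ 1# f n ⟩
    1# * f n                           ≈⟨ *-identityˡ _ ⟩
    f n                                ∎
    where
    shift-var : shift var ≋ const 1#
    shift-var zero    = refl
    shift-var (suc n) = refl

  private
    -- The fixed point of this map is the inverse of f; its nth iterate is
    -- correct up to the coefficient of index n.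
    step : Series → Series → Series
    step f g zero    = 1#
    step f g (suc n) = - (shift f ⊛ g) n

    approx : Series → ℕ → Series
    approx f zero    = 𝟙
    approx f (suc m) = step f (approx f m)

    approx-agree : ∀ f m m′ n → n ≤ m → n ≤ m′ → approx f m n ≈ approx f m′ n
    approx-agree f zero    zero     zero    _       _       = refl
    approx-agree f zero    (suc m′) zero    _       _       = refl
    approx-agree f (suc m) zero     zero    _       _       = refl
    approx-agree f (suc m) (suc m′) zero    _       _       = refl
    approx-agree f (suc m) (suc m′) (suc n) (s≤s p) (s≤s q) = -‿cong (⊛-local (shift f) n λ i i≤n →
      approx-agree f m m′ i (≤-trans i≤n p) (≤-trans i≤n q))

  inverse : ∀ f → f 0 ≈ 1# → ∃ λ g → f ⊛ g ≋ 𝟙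
  inverse f f₀≈1 = g , f⊛g
    where
    g : Series
    -- Iterates agree at every index that neither of them has yet to reach, so the diagonal is their
    -- limit.
    g n = approx f n n

    f⊛g : f ⊛ g ≋ 𝟙
    f⊛g zero    = trans (+-identityʳ _) (trans (*-identityʳ _) f₀≈1)
    f⊛g (suc n) = begin
      f 0 * - (shift f ⊛ approx f n) n + (shift f ⊛ g) n
        ≈⟨ +-cong (trans (*-congʳ f₀≈1) (*-identityˡ _))
                  (⊛-local (shift f) n λ i i≤n → approx-agree f i n i ≤-refl i≤n) ⟩
      - (shift f ⊛ approx f n) n + (shift f ⊛ approx f n) n
        ≈⟨ -‿inverseˡ _ ⟩
      0# ∎

-- The ring of power series in the colour variables

open RawSemiringDefs (RawRing.rawSemiring ℤ.+-*-rawRing) using () renaming (sum to ∑ℤ)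
open RawSemiringDefs X.rawSemiring using () renaming (sum to ∑X)

-- Series in x₁, …, x_N only: coefficients at lists of other lengths are ignored.
record _≈[_]_ (f : X.Carrier) (N : ℕ) (g : X.Carrier) : Set where
  constructor on
  field at : ∀ α → length α ≡ N → f α ≡ g α
open _≈[_]_ public

slice : X.Carrier → ℕ → X.Carrier
slice f a α = f (a ∷ α)

rawRing[_] : ℕ → RawRing 0ℓ 0ℓ
rawRing[ N ] = record
  { Carrier = X.Carrier ; _≈_ = _≈[ N ]_ ; _+_ = X._+_ ; _*_ = X._*_ ; -_ = X.-_ ; 0# = X.0# ; 1# = X.1# }

∑X-eval : ∀ {k} (F : Fin k → X.Carrier) α → ∑X F α ≡ ∑ℤ (λ i → F i α)
∑X-eval {zero}  F α = ≡.refl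
∑X-eval {suc k} F α = ≡.cong (λ s → F Fin.zero α ℤ.+ s) (∑X-eval (λ i → F (Fin.suc i)) α)

-- `mul` is already a Cauchy product in the first variable with coefficients in the others; the two
-- sides differ only in whether the sum is taken before or after evaluation at `α`.
slice-* : ∀ N f g a → slice (f X.* g) a ≈[ N ] RawRing._*_ (PowerSeries.rawRing rawRing[ N ]) (slice f) (slice g) a
slice-* N f g a = on λ α _ → ≡.sym (∑X-eval (λ (i : Fin (suc a)) → slice f (toℕ i) X.* slice g (a ∸ toℕ i)) α)

slices≈ : ∀ {N} {f g : X.Carrier} → (∀ a → slice f a ≈[ N ] slice g a) → f ≈[ suc N ] g
slices≈ p = on λ { (a ∷ α) l → at (p a) α (suc-injective l) }

-- Induction on the number of variables: `slice` embeds series in `suc N` variables into the power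
-- series over `Ring[ N ]`, and the laws are pulled back along this monomorphism. Without variables,
-- evaluation at `[]` embeds into the integers.
isRing[_] : ∀ N → IsCommutativeRing _≈[ N ]_ X._+_ X._*_ X.-_ X.0# X.1#
isRing[ zero ] = RingMonomorphism.isCommutativeRing mono ℤₚ.+-*-isCommutativeRing
  where
  mono : IsRingMonomorphism rawRing[ zero ] ℤ.+-*-rawRing (λ f → f [])
  mono = record
    { isRingHomomorphism = record
      { isSemiringHomomorphism = record
        { isNearSemiringHomomorphism = record
          { +-isMonoidHomomorphism = record
            { isMagmaHomomorphism = record
              { isRelHomomorphism = record { cong = λ p → at p [] ≡.refl }
              ; homo = λ _ _ → ≡.refl }
            ; ε-homo = ≡.refl }
          ; *-homo = λ _ _ → ≡.refl }
        ; 1#-homo = ≡.refl }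
      ; -‿homo = λ _ → ≡.refl }
    ; injective = λ p → on λ { [] _ → p } }
isRing[ suc N ] = RingMonomorphism.isCommutativeRing mono series-isCommutativeRing
  where
  ring : CommutativeRing 0ℓ 0ℓ
  ring = record { isCommutativeRing = isRing[ N ] }
  open PowerSeriesProperties ring
  mono : IsRingMonomorphism rawRing[ suc N ] (PowerSeries.rawRing rawRing[ N ]) slice
  mono = record
    { isRingHomomorphism = record
      { isSemiringHomomorphism = record
        { isNearSemiringHomomorphism = record
          { +-isMonoidHomomorphism = record
            { isMagmaHomomorphism = record
              { isRelHomomorphism = record { cong = λ p a → on λ α l → at p (a ∷ α) (≡.cong suc l) }
              ; homo = λ _ _ _ → on λ _ _ → ≡.refl }
            ; ε-homo = λ _ → on λ _ _ → ≡.refl }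
          ; *-homo = slice-* N }
        ; 1#-homo = λ { zero → on λ _ _ → ≡.refl ; (suc _) → on λ _ _ → ≡.refl } }
      ; -‿homo = λ _ _ → on λ _ _ → ≡.refl }
    ; injective = slices≈ }

Ring[_] : ℕ → CommutativeRing 0ℓ 0ℓ
Ring[ N ] = record { isCommutativeRing = isRing[ N ] }

module R (N : ℕ) = CommutativeRing Ring[ N ]

ℤ⟦x⟧-commutativeRing : CommutativeRing 0ℓ 0ℓ
ℤ⟦x⟧-commutativeRing = record { isCommutativeRing = isCR }
  where
  -- Each exponent list has some length, so a law that holds for every number of variables holds at
  -- every list.
  all-N : ∀ {f g} → (∀ N → f ≈[ N ] g) → f X.≈ g
  all-N p α = at (p (length α)) α ≡.refl
  isCR : IsCommutativeRing X._≈_ X._+_ X._*_ X.-_ X.0# X.1#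
  isCR = record
    { isRing = record
      { +-isAbelianGroup = record
        { isGroup = record
          { isMonoid = record
            { isSemigroup = record
              { isMagma = record
                { isEquivalence = record
                  { refl = λ _ → ≡.refl ; sym = λ p α → ≡.sym (p α) ; trans = λ p q α → ≡.trans (p α) (q α) }
                ; ∙-cong = λ {f} {f′} {g} {g′} p q → all-N λ N → R.+-cong N {f} {f′} {g} {g′} (on λ α _ → p α) (on λ α _ → q α) }
              ; assoc = λ f g h → all-N λ N → R.+-assoc N f g h }
            ; identity = (λ f → all-N λ N → R.+-identityˡ N f) , (λ f → all-N λ N → R.+-identityʳ N f) }
          ; inverse = (λ f → all-N λ N → R.-‿inverseˡ N f) , (λ f → all-N λ N → R.-‿inverseʳ N f)
          ; ⁻¹-cong = λ {f} {g} p → all-N λ N → R.-‿cong N {f} {g} (on λ α _ → p α) }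
        ; comm = λ f g → all-N λ N → R.+-comm N f g }
      ; *-cong = λ {f} {f′} {g} {g′} p q → all-N λ N → R.*-cong N {f} {f′} {g} {g′} (on λ α _ → p α) (on λ α _ → q α)
      ; *-assoc = λ f g h → all-N λ N → R.*-assoc N f g h
      ; *-identity = (λ f → all-N λ N → R.*-identityˡ N f) , (λ f → all-N λ N → R.*-identityʳ N f)
      ; distrib = (λ f g h → all-N λ N → R.distribˡ N f g h) , (λ f g h → all-N λ N → R.distribʳ N f g h)
      }
    ; *-comm = λ f g → all-N λ N → R.*-comm N f g
    }

-- The transfer operator of proper words and its determinant

module Transfer {r ℓ} (R : CommutativeRing r ℓ) (t : CommutativeRing.Carrier R) where
  open CommutativeRing R hiding (zero)
  open RawSemiringDefs (RawRing.rawSemiring rawRing) public using (sum) renaming (_×_ to _·_)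
  open AbelianGroupProperties +-abelianGroup using () renaming (∙-cancelʳ to +-cancelʳ)
  open SemiringMult semiring using (×-comm-*; ×-congʳ)
  open CommutativeMonoidMult +-commutativeMonoid using (×-distrib-+)
  open SetoidReasoning setoid
  open SemiringSolver commutativeSemiring using (solve; _:+_; _:*_; _:=_)

  private variable
    n : ℕ

  infix 4 _≐_
  _≐_ : Vector Carrier n → Vector Carrier n → Set ℓ
  x ≐ y = ∀ i → x i ≈ y i

  infixl 7 _∙_
  _∙_ : Vector Carrier n → Vector Carrier n → Carrier
  _∙_ {zero}  x y = 0#
  _∙_ {suc n} x y = x zero * y zero + tail x ∙ tail y

  sum≈∙ : (x y : Vector Carrier n) → sum (λ k → x k * y k) ≈ x ∙ y
  sum≈∙ {zero}  x y = refl
  sum≈∙ {suc n} x y = +-congˡ (sum≈∙ (tail x) (tail y))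

  ∙-cong : {x x′ y y′ : Vector Carrier n} → x ≐ x′ → y ≐ y′ → x ∙ y ≈ x′ ∙ y′
  ∙-cong {zero}  p q = refl
  ∙-cong {suc n} p q = +-cong (*-cong (p zero) (q zero)) (∙-cong (p ∘ suc) (q ∘ suc))

  ∙-congˡ : (x : Vector Carrier n) {y y′ : Vector Carrier n} → y ≐ y′ → x ∙ y ≈ x ∙ y′
  ∙-congˡ x q = ∙-cong {x = x} (λ _ → refl) q

  ∙-+ : (x y z : Vector Carrier n) → x ∙ (λ k → y k + z k) ≈ x ∙ y + x ∙ z
  ∙-+ {zero}  x y z = sym (+-identityˡ _)
  ∙-+ {suc n} x y z = begin
    x zero * (y zero + z zero) + tail x ∙ (λ k → tail y k + tail z k)
      ≈⟨ +-congˡ (∙-+ (tail x) (tail y) (tail z)) ⟩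
    x zero * (y zero + z zero) + (tail x ∙ tail y + tail x ∙ tail z)
      ≈⟨ solve 5 (λ a b c d e → a :* (b :+ c) :+ (d :+ e) := (a :* b :+ d) :+ (a :* c :+ e)) refl _ _ _ _ _ ⟩
    x ∙ y + x ∙ z ∎

  ∙-scale : ∀ c (x y : Vector Carrier n) → x ∙ (λ k → c * y k) ≈ c * (x ∙ y)
  ∙-scale {zero}  c x y = sym (zeroʳ c)
  ∙-scale {suc n} c x y = begin
    x zero * (c * y zero) + tail x ∙ (λ k → c * tail y k) ≈⟨ +-congˡ (∙-scale c (tail x) (tail y)) ⟩
    x zero * (c * y zero) + c * (tail x ∙ tail y)
      ≈⟨ solve 4 (λ a c b d → a :* (c :* b) :+ c :* d := c :* (a :* b :+ d)) refl _ _ _ _ ⟩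
    c * (x ∙ y) ∎

  -- (M x y) i = Σ_k w(i,k) x_k y_k, where w(i,k) is t, 0 or 1 according to
  -- whether i < k, i = k or i > k.
  M : Vector Carrier n → Vector Carrier n → Vector Carrier n
  M {suc n} x y zero    = t * (tail x ∙ tail y)
  M {suc n} x y (suc i) = x zero * y zero + M (tail x) (tail y) i

  M-cong : {x x′ y y′ : Vector Carrier n} → x ≐ x′ → y ≐ y′ → M x y ≐ M x′ y′
  M-cong p q zero    = *-congˡ (∙-cong (p ∘ suc) (q ∘ suc))
  M-cong p q (suc i) = +-cong (*-cong (p zero) (q zero)) (M-cong (p ∘ suc) (q ∘ suc) i)

  -- The product of the factors `1 + x i`.
  E : Vector Carrier n → Carrier
  E {zero}  x = 1#
  E {suc n} x = E (tail x) + x zero * E (tail x)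

  -- u x j = ∏_{i<j} (1 + t xᵢ) ∏_{i>j} (1 + xᵢ)
  u : Vector Carrier n → Vector Carrier n
  u x zero    = E (tail x)
  u x (suc j) = u (tail x) j + t * x zero * u (tail x) j

  -- By telescoping, `H x` is (∏ (1 + t xᵢ) - ∏ (1 + xᵢ)) / (t - 1), written without the division.
  H : Vector Carrier n → Carrier
  H x = x ∙ u x

  -- P x is the determinant of 1 − M x.
  P : Vector Carrier n → Carrier
  P {zero}  x = 1#
  P {suc n} x = P (tail x) + - (t * x zero * H (tail x))

  H-suc : (x : Vector Carrier (suc n)) →
          H x ≈ x zero * E (tail x) + (H (tail x) + t * x zero * H (tail x))
  H-suc x = +-congˡ (trans (∙-+ (tail x) (u (tail x)) _) (+-congˡ (∙-scale _ (tail x) (u (tail x)))))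

  -- Moves the subtraction to the other side: eliminating `P (tail x)` in favour of `P x` leaves
  -- identities without negation, which a semiring solver can settle.
  P-suc : (x : Vector Carrier (suc n)) → P (tail x) ≈ P x + t * x zero * H (tail x)
  P-suc x = sym (begin
    P (tail x) + - a + a     ≈⟨ +-assoc _ _ _ ⟩
    P (tail x) + (- a + a)   ≈⟨ +-congˡ (-‿inverseˡ a) ⟩
    P (tail x) + 0#          ≈⟨ +-identityʳ _ ⟩
    P (tail x)               ∎)
    where a = t * x zero * H (tail x)

  -- Replaces the recursion for `P`, which favours the smallest colour, by a difference of two
  -- symmetric expressions.
  E≈P+H : (x : Vector Carrier n) → E x ≈ P x + H x
  E≈P+H {zero}  x = sym (+-identityʳ 1#)
  E≈P+H {suc n} x = begin
    E′ + a * E′                          ≈⟨ +-congʳ (trans (E≈P+H (tail x)) (+-congʳ (P-suc x))) ⟩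
    P x + t * a * H′ + H′ + a * E′
      ≈⟨ solve 4 (λ p q h e → p :+ q :+ h :+ e := p :+ (e :+ (h :+ q))) refl (P x) (t * a * H′) H′ (a * E′) ⟩
    P x + (a * E′ + (H′ + t * a * H′))   ≈⟨ +-congˡ (H-suc x) ⟨
    P x + H x                            ∎
    where
    a  = x zero
    E′ = E (tail x)
    H′ = H (tail x)

  -- With the row vector v = (x_k u_k)_k, this is v (1 − M) = P x · x.
  u-dual : (x y : Vector Carrier n) →
           x ∙ (λ k → u x k * y k) ≈ x ∙ (λ k → u x k * M x y k) + P x * (x ∙ y)
  u-dual {zero}  x y = sym (trans (+-identityˡ _) (zeroʳ _))
  u-dual {suc n} x y = begin
    a * (E′ * b) + cs ∙ (λ k → u x (suc k) * ys k)
      ≈⟨ +-cong (*-congˡ (*-congʳ E′≈)) (split ys) ⟩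
    a * ((p + t * a * h + h) * b) + (D + t * a * D)
      ≈⟨ +-congˡ (+-cong D≈ (*-congˡ D≈)) ⟩
    a * ((p + t * a * h + h) * b) + (d + (p + t * a * h) * l + t * a * (d + (p + t * a * h) * l))
      ≈⟨ solve 7 (λ a b p t h d l →
           a :* ((p :+ t :* a :* h :+ h) :* b) :+ (d :+ (p :+ t :* a :* h) :* l :+ t :* a :* (d :+ (p :+ t :* a :* h) :* l))
           := a :* ((p :+ t :* a :* h :+ h) :* (t :* l)) :+ (a :* b :* h :+ d :+ t :* a :* (a :* b :* h :+ d))
              :+ p :* (a :* b :+ l)) refl a b p t h d l ⟩
    a * ((p + t * a * h + h) * (t * l)) + (a * b * h + d + t * a * (a * b * h + d)) + p * (a * b + l)
      ≈⟨ +-congʳ (+-cong (*-congˡ (*-congʳ E′≈)) (trans (split (tail (M x y))) (+-cong D′≈ (*-congˡ D′≈)))) ⟨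
    a * (E′ * (t * l)) + cs ∙ (λ k → u x (suc k) * M x y (suc k)) + p * (a * b + l) ∎
    where
    a  = x zero
    b  = y zero
    cs = tail x
    ys = tail y
    E′ = E cs
    h  = H cs
    p  = P x
    l  = cs ∙ ys
    D  = cs ∙ (λ k → u cs k * ys k)
    d  = cs ∙ (λ k → u cs k * M cs ys k)

    E′≈ : E′ ≈ p + t * a * h + h
    E′≈ = trans (E≈P+H cs) (+-congʳ (P-suc x))

    D≈ : D ≈ d + (p + t * a * h) * l
    D≈ = trans (u-dual cs ys) (+-congˡ (*-congʳ (P-suc x)))

    D′≈ : cs ∙ (λ k → u cs k * M x y (suc k)) ≈ a * b * h + d
    D′≈ = begin
      cs ∙ (λ k → u cs k * (a * b + M cs ys k))
        ≈⟨ ∙-congˡ cs (λ k → trans (distribˡ _ _ _) (+-congʳ (*-comm _ _))) ⟩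
      cs ∙ (λ k → a * b * u cs k + u cs k * M cs ys k) ≈⟨ ∙-+ cs _ _ ⟩
      cs ∙ (λ k → a * b * u cs k) + d                  ≈⟨ +-congʳ (∙-scale _ cs _) ⟩
      a * b * h + d                                    ∎

    split : ∀ z → cs ∙ (λ k → u x (suc k) * z k) ≈ cs ∙ (λ k → u cs k * z k) + t * a * (cs ∙ (λ k → u cs k * z k))
    split z = begin
      cs ∙ (λ k → (u cs k + t * a * u cs k) * z k)
        ≈⟨ ∙-congˡ cs (λ k → trans (distribʳ _ _ _) (+-congˡ (*-assoc _ _ _))) ⟩
      cs ∙ (λ k → u cs k * z k + t * a * (u cs k * z k))
        ≈⟨ ∙-+ cs _ _ ⟩
      cs ∙ (λ k → u cs k * z k) + cs ∙ (λ k → t * a * (u cs k * z k))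
        ≈⟨ +-congˡ (∙-scale _ cs _) ⟩
      cs ∙ (λ k → u cs k * z k) + t * a * (cs ∙ (λ k → u cs k * z k)) ∎

  unit : Fin n → Vector Carrier n
  unit zero    zero    = 1#
  unit zero    (suc _) = 0#
  unit (suc j) zero    = 0#
  unit (suc j) (suc i) = unit j i

  -- Cramer's rule: `l` is column zero of the inverse of 1 - M, and the cofactor at (0,0) is the
  -- determinant for the remaining colours. The row at zero expresses `l zero` through
  -- `tail x ∙ tail l`; the other rows, paired with the dual vector of `tail x`, express that
  -- product through `l zero` again.
  first-return : (x l : Vector Carrier (suc n)) → l ≐ (λ i → unit zero i + M x l i) →
                 P x * l zero ≈ P (tail x)
  first-return x l l≐ = +-cancelʳ (t * a * h * l₀) (p * l₀) p′ (begin
    p * l₀ + t * a * h * l₀    ≈⟨ distribʳ _ _ _ ⟨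
    (p + t * a * h) * l₀       ≈⟨ *-cong (sym (P-suc x)) (l≐ zero) ⟩
    p′ * (1# + t * λ′)         ≈⟨ trans (distribˡ _ _ _) (+-congʳ (*-identityʳ p′)) ⟩
    p′ + p′ * (t * λ′)         ≈⟨ +-congˡ (solve 3 (λ a b c → a :* (b :* c) := b :* (a :* c)) refl _ _ _) ⟩
    p′ + t * (p′ * λ′)         ≈⟨ +-congˡ (*-congˡ p′λ≈) ⟩
    p′ + t * (a * l₀ * h)      ≈⟨ +-congˡ (solve 4 (λ t a l h → t :* (a :* l :* h) := t :* a :* h :* l) refl _ _ _ _) ⟩
    p′ + t * a * h * l₀        ∎)
    where
    a  = x zero
    cs = tail x
    ls = tail l
    l₀ = l zero
    h  = H cs
    p  = P x
    p′ = P cs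
    λ′ = cs ∙ ls
    d  = cs ∙ (λ k → u cs k * M cs ls k)

    -- Row `suc k` reads `ls k = a * l₀ + M cs ls k`. Expanding the left side of `u-dual` by these
    -- rows produces the term `d` of its right side, which cancels.
    p′λ≈ : p′ * λ′ ≈ a * l₀ * h
    p′λ≈ = +-cancelʳ d _ _ (begin
      p′ * λ′ + d                           ≈⟨ +-comm _ _ ⟩
      d + p′ * λ′                           ≈⟨ u-dual cs ls ⟨
      cs ∙ (λ k → u cs k * ls k)
        ≈⟨ ∙-congˡ cs (λ k → trans (*-congˡ (trans (l≐ (suc k)) (+-identityˡ _)))
             (trans (distribˡ _ _ _) (+-congʳ (*-comm _ _)))) ⟩
      cs ∙ (λ k → a * l₀ * u cs k + u cs k * M cs ls k) ≈⟨ ∙-+ cs _ _ ⟩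
      cs ∙ (λ k → a * l₀ * u cs k) + d      ≈⟨ +-congʳ (∙-scale _ cs _) ⟩
      a * l₀ * h + d                        ∎)

  -- Rotation of the colours

  snoc : ∀ {a} {A : Set a} → Vector A n → A → Vector A (suc n)
  snoc {zero}  x a _       = a
  snoc {suc n} x a zero    = x zero
  snoc {suc n} x a (suc i) = snoc (tail x) a i

  snoc-cong : ∀ {x y : Vector Carrier n} {a b} → x ≐ y → a ≈ b → snoc x a ≐ snoc y b
  snoc-cong {zero}  p q i       = q
  snoc-cong {suc n} p q zero    = p zero
  snoc-cong {suc n} p q (suc i) = snoc-cong (p ∘ suc) q i

  snoc-map : ∀ {a b} {A : Set a} {B : Set b} (f : A → B) (x : Vector A n) a i →
             f (snoc x a i) ≡ snoc (f ∘ x) (f a) i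
  snoc-map {zero}  f x a i       = ≡.refl
  snoc-map {suc n} f x a zero    = ≡.refl
  snoc-map {suc n} f x a (suc i) = snoc-map f (tail x) a i

  snoc-inject₁ : ∀ {a} {A : Set a} (x : Vector A n) a i → snoc x a (inject₁ i) ≡ x i
  snoc-inject₁ {suc n} x a zero    = ≡.refl
  snoc-inject₁ {suc n} x a (suc i) = snoc-inject₁ (tail x) a i

  rotate : ∀ {a} {A : Set a} → Vector A (suc n) → Vector A (suc n)
  rotate x = snoc (tail x) (x zero)

  snoc-∙ : (x y : Vector Carrier n) → ∀ a b → snoc x a ∙ snoc y b ≈ a * b + x ∙ y
  snoc-∙ {zero}  x y a b = refl
  snoc-∙ {suc n} x y a b = begin
    x zero * y zero + snoc (tail x) a ∙ snoc (tail y) b ≈⟨ +-congˡ (snoc-∙ (tail x) (tail y) a b) ⟩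
    x zero * y zero + (a * b + tail x ∙ tail y)
      ≈⟨ solve 3 (λ p q r → p :+ (q :+ r) := q :+ (p :+ r)) refl _ _ _ ⟩
    a * b + x ∙ y ∎

  -- The appended colour lies above all others: every old row gains `t` times the new entry, and the
  -- new row has weight 1 at each old colour.
  M-snoc : (x y : Vector Carrier n) → ∀ a b →
           M (snoc x a) (snoc y b) ≐ snoc (λ i → t * (a * b) + M x y i) (x ∙ y)
  M-snoc {zero}  x y a b zero    = zeroʳ t
  M-snoc {suc n} x y a b zero    = trans (*-congˡ (snoc-∙ (tail x) (tail y) a b)) (distribˡ _ _ _)
  M-snoc {suc n} x y a b (suc i) = begin
    c + M (snoc (tail x) a) (snoc (tail y) b) i ≈⟨ +-congˡ (M-snoc (tail x) (tail y) a b i) ⟩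
    c + snoc (λ j → t * (a * b) + M (tail x) (tail y) j) (tail x ∙ tail y) i
      ≡⟨ snoc-map (λ s → c + s) _ _ i ⟩
    snoc (λ j → c + (t * (a * b) + M (tail x) (tail y) j)) (x ∙ y) i
      ≈⟨ snoc-cong (λ j → solve 3 (λ p q r → p :+ (q :+ r) := q :+ (p :+ r)) refl _ _ _) refl i ⟩
    snoc (λ j → t * (a * b) + (c + M (tail x) (tail y) j)) (x ∙ y) i ∎
    where c = x zero * y zero

  walk : Vector Carrier n → ℕ → Vector Carrier n → Vector Carrier n
  walk x zero    y = y
  walk x (suc m) y = M x (walk x m y)

  -- Moving the smallest colour to the top conjugates M by diag(t, 1, …, 1).
  record Rotated (y y′ : Vector Carrier (suc n)) : Set (r ⊔ ℓ) where
    constructor rotated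
    field
      bottom : Carrier
      head≈  : y zero ≈ t * bottom
      rest≈  : y′ ≐ snoc (tail y) bottom

  -- The row of the smallest colour carries an explicit factor `t`, so the new `bottom` is
  -- `tail x ∙ tail y`. Keeping this quotient as a witness avoids inverting `t`.
  rotated-M : (x : Vector Carrier (suc n)) {y y′ : Vector Carrier (suc n)} →
              Rotated y y′ → Rotated (M x y) (M (rotate x) y′)
  rotated-M x {y} {y′} (rotated b y₀≈ y′≐) = rotated (tail x ∙ tail y) refl λ i → begin
    M (rotate x) y′ i                  ≈⟨ M-cong (λ _ → refl) y′≐ i ⟩
    M (rotate x) (snoc (tail y) b) i   ≈⟨ M-snoc (tail x) (tail y) (x zero) b i ⟩
    snoc (λ j → t * (x zero * b) + M (tail x) (tail y) j) (tail x ∙ tail y) i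
      ≈⟨ snoc-cong (λ j → +-congʳ (trans (solve 3 (λ p q r → p :* (q :* r) := q :* (p :* r)) refl _ _ _) (*-congˡ (sym y₀≈)))) refl i ⟩
    snoc (tail (M x y)) (tail x ∙ tail y) i ∎

  rotated-walk : (x : Vector Carrier (suc n)) {y y′ : Vector Carrier (suc n)} → ∀ m →
                 Rotated y y′ → Rotated (walk x m y) (walk (rotate x) m y′)
  rotated-walk x zero    r = r
  rotated-walk x (suc m) r = rotated-M x (rotated-walk x m r)

  closed : Vector Carrier n → Fin n → ℕ → Carrier
  closed x j m = walk x m (unit j) j

  unit-snoc : (j : Fin n) → unit (inject₁ j) ≐ snoc (unit j) 0#
  unit-snoc {suc n}       zero    zero    = refl
  unit-snoc {suc n}       zero    (suc i) = zeros i
    where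
    zeros : ∀ {n} (i : Fin (suc n)) → 0# ≈ snoc {n} (λ _ → 0#) 0# i
    zeros {zero}  i       = refl
    zeros {suc n} zero    = refl
    zeros {suc n} (suc i) = zeros i
  unit-snoc {suc n}       (suc j) zero    = refl
  unit-snoc {suc n}       (suc j) (suc i) = unit-snoc j i

  -- The conjugating diagonal has entry 1 at `suc j`: its basis vector goes to a basis vector with
  -- `bottom` zero, and the coordinate read at the end is not rescaled.
  closed-rotate : (x : Vector Carrier (suc n)) → ∀ j m → closed x (suc j) m ≈ closed (rotate x) (inject₁ j) m
  closed-rotate x j m = sym (trans (rest≈ (inject₁ j)) (reflexive (snoc-inject₁ _ bottom j)))
    where
    units : Rotated (unit (suc j)) (unit (inject₁ j))
    units = rotated 0# (sym (zeroʳ t)) (unit-snoc j)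
    open Rotated (rotated-walk x m units)

  -- Elementary symmetric polynomials in finitely many variables

  e⟨_⟩ : ℕ → Vector Carrier n → Carrier
  e⟨_⟩ {n}     zero    x = 1#
  e⟨_⟩ {zero}  (suc k) x = 0#
  e⟨_⟩ {suc n} (suc k) x = e⟨ suc k ⟩ (tail x) + x zero * e⟨ k ⟩ (tail x)

  e-cong : ∀ k {x y : Vector Carrier n} → x ≐ y → e⟨ k ⟩ x ≈ e⟨ k ⟩ y
  e-cong {n}     zero    p = refl
  e-cong {zero}  (suc k) p = refl
  e-cong {suc n} (suc k) p = +-cong (e-cong (suc k) (p ∘ suc)) (*-cong (p zero) (e-cong k (p ∘ suc)))

  -- The definition splits off the first variable; splitting off the last one in the same way gives
  -- the invariance under rotation.
  e-snoc : ∀ k (x : Vector Carrier n) a → e⟨ suc k ⟩ (snoc x a) ≈ e⟨ suc k ⟩ x + a * e⟨ k ⟩ x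
  e-snoc {zero}  zero    x a = refl
  e-snoc {zero}  (suc k) x a = refl
  e-snoc {suc n} zero    x a = begin
    e⟨ 1 ⟩ (snoc (tail x) a) + x zero * 1#        ≈⟨ +-congʳ (e-snoc zero (tail x) a) ⟩
    e⟨ 1 ⟩ (tail x) + a * 1# + x zero * 1#        ≈⟨ solve 3 (λ p q r → p :+ q :+ r := p :+ r :+ q) refl _ _ _ ⟩
    e⟨ 1 ⟩ (tail x) + x zero * 1# + a * 1#        ∎
  e-snoc {suc n} (suc k) x a = begin
    e⟨ suc (suc k) ⟩ (snoc x′ a) + b * e⟨ suc k ⟩ (snoc x′ a)
      ≈⟨ +-cong (e-snoc (suc k) x′ a) (*-congˡ (e-snoc k x′ a)) ⟩
    e⟨ suc (suc k) ⟩ x′ + a * e⟨ suc k ⟩ x′ + b * (e⟨ suc k ⟩ x′ + a * e⟨ k ⟩ x′)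
      ≈⟨ solve 5 (λ p a q b r → p :+ a :* q :+ b :* (q :+ a :* r) := p :+ b :* q :+ a :* (q :+ b :* r)) refl _ _ _ _ _ ⟩
    e⟨ suc (suc k) ⟩ x′ + b * e⟨ suc k ⟩ x′ + a * (e⟨ suc k ⟩ x′ + b * e⟨ k ⟩ x′) ∎
    where
    x′ = tail x
    b  = x zero

  e-rotate : ∀ k (x : Vector Carrier (suc n)) → e⟨ k ⟩ (rotate x) ≈ e⟨ k ⟩ x
  e-rotate zero    x = refl
  e-rotate (suc k) x = e-snoc k (tail x) (x zero)

  removeAt-snoc : ∀ {a} {A : Set a} (y : Vector A (suc n)) a j i →
                  removeAt (snoc y a) (inject₁ j) i ≡ snoc (removeAt y j) a i
  removeAt-snoc         y a zero    i       = ≡.refl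
  removeAt-snoc {suc n} y a (suc j) zero    = ≡.refl
  removeAt-snoc {suc n} y a (suc j) (suc i) = removeAt-snoc (tail y) a j i

  e-remove-rotate : ∀ k (x : Vector Carrier (suc n)) j →
                    e⟨ k ⟩ (removeAt (rotate x) (inject₁ j)) ≈ e⟨ k ⟩ (removeAt x (suc j))
  e-remove-rotate {suc n} k x j = trans (e-cong k (λ i → reflexive (removeAt-snoc (tail x) (x zero) j i)))
                                        (e-rotate k (removeAt x (suc j)))

  e-remove : ∀ k (x : Vector Carrier (suc n)) j →
             e⟨ suc k ⟩ x ≈ e⟨ suc k ⟩ (removeAt x j) + x j * e⟨ k ⟩ (removeAt x j)
  e-remove         k       x zero    = refl
  e-remove {suc n} zero    x (suc j) = begin
    e⟨ 1 ⟩ x′ + a * 1#                                  ≈⟨ +-congʳ (e-remove zero x′ j) ⟩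
    e⟨ 1 ⟩ (removeAt x′ j) + x′ j * 1# + a * 1#         ≈⟨ solve 3 (λ p q r → p :+ q :+ r := p :+ r :+ q) refl _ _ _ ⟩
    e⟨ 1 ⟩ (removeAt x′ j) + a * 1# + x′ j * 1#         ∎
    where
    x′ = tail x
    a  = x zero
  e-remove {suc n} (suc k) x (suc j) = begin
    e⟨ suc (suc k) ⟩ x′ + a * e⟨ suc k ⟩ x′ ≈⟨ +-cong (e-remove (suc k) x′ j) (*-congˡ (e-remove k x′ j)) ⟩
    e⟨ suc (suc k) ⟩ y + x′ j * e⟨ suc k ⟩ y + a * (e⟨ suc k ⟩ y + x′ j * e⟨ k ⟩ y)
      ≈⟨ solve 5 (λ p b q a r → p :+ b :* q :+ a :* (q :+ b :* r) := p :+ a :* q :+ b :* (q :+ a :* r)) refl _ _ _ _ _ ⟩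
    e⟨ suc (suc k) ⟩ y + a * e⟨ suc k ⟩ y + x′ j * (e⟨ suc k ⟩ y + a * e⟨ k ⟩ y) ∎
    where
    x′ = tail x
    y  = removeAt x′ j
    a  = x zero

  ×-0# : ∀ n → n · 0# ≈ 0#
  ×-0# zero    = refl
  ×-0# (suc n) = trans (+-identityˡ _) (×-0# n)

  -- Each squarefree monomial of degree `suc k` arises once for every choice of one of its variables
  -- as `x j`.
  ∑-e-remove : ∀ k (x : Vector Carrier (suc n)) →
               x ∙ (λ j → e⟨ k ⟩ (removeAt x j)) ≈ suc k · e⟨ suc k ⟩ x
  ∑-e-remove {zero}  zero    x = sym (+-congʳ (+-identityˡ _))
  ∑-e-remove {zero}  (suc k) x = begin
    x zero * 0# + 0#                        ≈⟨ trans (+-identityʳ _) (zeroʳ _) ⟩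
    0#                                      ≈⟨ ×-0# (suc (suc k)) ⟨
    suc (suc k) · 0#                        ≈⟨ ×-congʳ (suc (suc k)) (trans (+-identityˡ _) (zeroʳ _)) ⟨
    suc (suc k) · (0# + x zero * 0#)        ∎
  ∑-e-remove {suc n} zero    x = begin
    x zero * 1# + tail x ∙ (λ _ → 1#)       ≈⟨ +-congˡ (∑-e-remove zero (tail x)) ⟩
    x zero * 1# + (e⟨ 1 ⟩ (tail x) + 0#)    ≈⟨ solve 3 (λ p q r → p :+ (q :+ r) := q :+ p :+ r) refl _ _ _ ⟩
    e⟨ 1 ⟩ (tail x) + x zero * 1# + 0#      ∎
  ∑-e-remove {suc n} (suc k) x = begin
    a * e⟨ suc k ⟩ x′ + x′ ∙ (λ j → e⟨ suc k ⟩ (removeAt x′ j) + a * e⟨ k ⟩ (removeAt x′ j))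
      ≈⟨ +-congˡ (trans (∙-+ x′ (λ j → e⟨ suc k ⟩ (removeAt x′ j)) (λ j → a * e⟨ k ⟩ (removeAt x′ j)))
           (+-cong (∑-e-remove (suc k) x′)
             (trans (∙-scale a x′ (λ j → e⟨ k ⟩ (removeAt x′ j))) (*-congˡ (∑-e-remove k x′))))) ⟩
    a * e₁ + (suc (suc k) · e₂ + a * (suc k · e₁)) ≈⟨ +-congˡ (+-congˡ (×-comm-* (suc k) a e₁)) ⟩
    a * e₁ + (suc (suc k) · e₂ + suc k · (a * e₁)) ≈⟨ solve 3 (λ p q r → p :+ (q :+ r) := q :+ (p :+ r)) refl _ _ _ ⟩
    suc (suc k) · e₂ + suc (suc k) · (a * e₁)      ≈⟨ ×-distrib-+ e₂ (a * e₁) (suc (suc k)) ⟨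
    suc (suc k) · (e₂ + a * e₁)                    ∎
    where
    x′ = tail x
    a  = x zero
    e₁ = e⟨ suc k ⟩ x′
    e₂ = e⟨ suc (suc k) ⟩ x′

-- Generating function of closed walks

module ClosedWalks {r ℓ} (R : CommutativeRing r ℓ) (t : CommutativeRing.Carrier R) where
  open CommutativeRing R hiding (zero)
  open RawSemiringDefs (RawRing.rawSemiring rawRing) using (_^_)
  open GroupProperties +-group using () renaming (∙-cancelʳ to +-cancelʳ; inverseˡ-unique to -‿unique)
  open SemiringSum semiring using (*-distribˡ-sum; sum-cong-≋; sum-replicate-zero)
  open PowerSeriesProperties R
  open Transfer R t
  open SemiringSolver commutativeSemiring using (solve; _:+_; _:*_; _:=_)
  private
    module S  = CommutativeRing commutativeRing
    module SΣ = SemiringSum S.semiring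
    module B  = Transfer commutativeRing (const t)

    variable
      n : ℕ

  open SetoidReasoning setoid

  ⟦_⟧ : ℕ → Carrier
  ⟦ k ⟧ = sum {k} λ i → t ^ toℕ i

  ⟦⟧-suc : ∀ k → ⟦ suc k ⟧ ≈ 1# + t * ⟦ k ⟧
  ⟦⟧-suc k = +-congˡ (sym (*-distribˡ-sum {k} t (λ i → t ^ toℕ i)))

  -- Substituting z xᵢ for xᵢ turns `M` into zM, so the identities of `Transfer` over the series
  -- ring become statements about 1 - zM.
  scaled : Vector Carrier n → Vector Series n
  scaled x i = var ⊛ const (x i)

  scaled-zero : ∀ (x : Vector Carrier n) i f → (scaled x i ⊛ f) 0 ≈ 0#
  scaled-zero x i f = trans (⊛-assoc var (const (x i)) f 0) (var-⊛-zero (const (x i) ⊛ f))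

  scaled-suc : ∀ (x : Vector Carrier n) i f m → (scaled x i ⊛ f) (suc m) ≈ x i * f m
  scaled-suc x i f m = begin
    (scaled x i ⊛ f) (suc m)          ≈⟨ ⊛-assoc var (const (x i)) f (suc m) ⟩
    (var ⊛ (const (x i) ⊛ f)) (suc m) ≈⟨ var-⊛-suc (const (x i) ⊛ f) m ⟩
    (const (x i) ⊛ f) m               ≈⟨ const-⊛ (x i) f m ⟩
    x i * f m                         ∎

  scaled-∙-zero : ∀ (x : Vector Carrier n) y → (scaled x B.∙ y) 0 ≈ 0#
  scaled-∙-zero {zero}  x y = refl
  scaled-∙-zero {suc n} x y = trans (+-cong (scaled-zero x zero (y zero)) (scaled-∙-zero (tail x) (tail y))) (+-identityˡ 0#)

  scaled-∙-suc : ∀ (x : Vector Carrier n) y m → (scaled x B.∙ y) (suc m) ≈ x ∙ (λ k → y k m)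
  scaled-∙-suc {zero}  x y m = refl
  scaled-∙-suc {suc n} x y m = +-cong (scaled-suc x zero (y zero) m) (scaled-∙-suc (tail x) (tail y) m)

  scaled-M-zero : ∀ (x : Vector Carrier n) y i → B.M (scaled x) y i 0 ≈ 0#
  scaled-M-zero x y zero    = begin
    (const t ⊛ (scaled (tail x) B.∙ tail y)) 0 ≈⟨ const-⊛ t (scaled (tail x) B.∙ tail y) 0 ⟩
    t * (scaled (tail x) B.∙ tail y) 0         ≈⟨ *-congˡ (scaled-∙-zero (tail x) (tail y)) ⟩
    t * 0#                                     ≈⟨ zeroʳ t ⟩
    0#                                         ∎
  scaled-M-zero x y (suc i) = trans (+-cong (scaled-zero x zero (y zero)) (scaled-M-zero (tail x) (tail y) i)) (+-identityˡ 0#)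

  scaled-M-suc : ∀ (x : Vector Carrier n) y i m → B.M (scaled x) y i (suc m) ≈ M x (λ k → y k m) i
  scaled-M-suc x y zero    m = trans (const-⊛ t (scaled (tail x) B.∙ tail y) (suc m)) (*-congˡ (scaled-∙-suc (tail x) (tail y) m))
  scaled-M-suc x y (suc i) m = +-cong (scaled-suc x zero (y zero) m) (scaled-M-suc (tail x) (tail y) i m)

  B-unit : (j : Fin n) → ∀ i → B.unit j i ≋ const (unit j i)
  B-unit zero    zero    m       = refl
  B-unit zero    (suc i) zero    = refl
  B-unit zero    (suc i) (suc m) = refl
  B-unit (suc j) zero    zero    = refl
  B-unit (suc j) zero    (suc m) = refl
  B-unit (suc j) (suc i) m       = B-unit j i m

  walks : Vector Carrier n → Fin n → Vector Series n
  walks x j i m = walk x m (unit j) i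

  -- The geometric series of zM solves L = 1 + zM L; this is the hypothesis of `first-return`,
  -- column by column.
  walks-equation : ∀ (x : Vector Carrier n) j i → walks x j i ≋ B.unit j i ⊕ B.M (scaled x) (walks x j) i
  walks-equation x j i zero    = sym (trans (+-cong (B-unit j i 0) (scaled-M-zero x (walks x j) i)) (+-identityʳ _))
  walks-equation x j i (suc m) = sym (trans (+-cong (B-unit j i (suc m)) (scaled-M-suc x (walks x j) i m)) (+-identityˡ _))

  E-coeff : ∀ (x : Vector Carrier n) m → B.E (scaled x) m ≈ e⟨ m ⟩ x
  E-coeff {zero}  x zero    = refl
  E-coeff {zero}  x (suc m) = refl
  E-coeff {suc n} x zero    = trans (+-cong (E-coeff (tail x) 0) (scaled-zero x zero (B.E (scaled (tail x))))) (+-identityʳ 1#)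
  E-coeff {suc n} x (suc m) = +-cong (E-coeff (tail x) (suc m))
    (trans (scaled-suc x zero (B.E (scaled (tail x))) m) (*-congˡ (E-coeff (tail x) m)))

  -- In the recursion for `H`, the monomials containing the first variable arise once through `E`
  -- and with weight `t * ⟦ m ⟧` through `H`, in total `⟦ suc m ⟧`.
  H-coeff : ∀ (x : Vector Carrier n) m → B.H (scaled x) m ≈ ⟦ m ⟧ * e⟨ m ⟩ x
  H-coeff         x zero    = trans (scaled-∙-zero x _) (sym (zeroˡ _))
  H-coeff {zero}  x (suc m) = sym (zeroʳ _)
  H-coeff {suc n} x (suc m) = begin
    B.H (scaled x) (suc m) ≈⟨ B.H-suc (scaled x) (suc m) ⟩
    (scaled x zero ⊛ E′) (suc m) + (H′ (suc m) + ((const t ⊛ scaled x zero) ⊛ H′) (suc m))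
      ≈⟨ +-cong (trans (scaled-suc x zero E′ m) (*-congˡ (E-coeff x′ m)))
           (+-cong (H-coeff x′ (suc m)) (trans (⊛-assoc (const t) (scaled x zero) H′ (suc m))
             (trans (const-⊛ t (scaled x zero ⊛ H′) (suc m)) (*-congˡ (trans (scaled-suc x zero H′ m) (*-congˡ (H-coeff x′ m))))))) ⟩
    a * e₀ + (⟦ suc m ⟧ * e₁ + t * (a * (⟦ m ⟧ * e₀)))
      ≈⟨ +-cong (sym (*-identityˡ _)) (+-congˡ (solve 4 (λ t a k e → t :* (a :* (k :* e)) := t :* k :* (a :* e)) refl _ _ _ _)) ⟩
    1# * (a * e₀) + (⟦ suc m ⟧ * e₁ + t * ⟦ m ⟧ * (a * e₀))
      ≈⟨ solve 4 (λ o e f g → o :* e :+ (f :+ g :* e) := f :+ (o :+ g) :* e) refl _ _ _ _ ⟩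
    ⟦ suc m ⟧ * e₁ + (1# + t * ⟦ m ⟧) * (a * e₀)
      ≈⟨ +-congˡ (*-congʳ (⟦⟧-suc m)) ⟨
    ⟦ suc m ⟧ * e₁ + ⟦ suc m ⟧ * (a * e₀) ≈⟨ distribˡ _ _ _ ⟨
    ⟦ suc m ⟧ * (e₁ + a * e₀) ∎
    where
    a  = x zero
    x′ = tail x
    e₀ = e⟨ m ⟩ x′
    e₁ = e⟨ suc m ⟩ x′
    E′ = B.E (scaled x′)
    H′ = B.H (scaled x′)

  -- At index `suc m` the bracket has index `m`. For `m = 0` it is an empty sum, so the linear term
  -- vanishes, in accordance with sums that begin at k = 2.
  denominator : Vector Carrier n → Series
  denominator x zero    = 1#
  denominator x (suc m) = - (t * (⟦ m ⟧ * e⟨ suc m ⟩ x))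

  numerator : Vector Carrier n → Series
  numerator x zero    = 0#
  numerator x (suc m) = t * (⟦ m ⟧ * (suc m · e⟨ suc m ⟩ x))

  denominator-cong : ∀ {n′} {x : Vector Carrier n} {y : Vector Carrier n′} →
                     (∀ k → e⟨ k ⟩ x ≈ e⟨ k ⟩ y) → denominator x ≋ denominator y
  denominator-cong p zero    = refl
  denominator-cong p (suc m) = -‿cong (*-congˡ (*-congˡ (p (suc m))))

  -- Comparison of coefficients in E = P + H: the elementary polynomial on the left cancels against
  -- the summand 1 of `⟦ suc m ⟧ = 1 + t ⟦ m ⟧`.
  P-coeff : (x : Vector Carrier n) → B.P (scaled x) ≋ denominator x
  P-coeff x zero    = +-cancelʳ (⟦ 0 ⟧ * 1#) _ _ (begin
    B.P (scaled x) 0 + ⟦ 0 ⟧ * 1#    ≈⟨ +-congˡ (H-coeff x 0) ⟨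
    (B.P (scaled x) ⊕ B.H (scaled x)) 0 ≈⟨ B.E≈P+H (scaled x) 0 ⟨
    B.E (scaled x) 0                 ≈⟨ E-coeff x 0 ⟩
    1#                               ≈⟨ trans (+-congˡ (zeroˡ 1#)) (+-identityʳ 1#) ⟨
    1# + ⟦ 0 ⟧ * 1#                  ∎)
  P-coeff x (suc m) = -‿unique p _ (+-cancelʳ eₘ _ _ (begin
    p + t * (⟦ m ⟧ * eₘ) + eₘ         ≈⟨ +-assoc _ _ _ ⟩
    p + (t * (⟦ m ⟧ * eₘ) + eₘ)       ≈⟨ +-congˡ (+-comm _ _) ⟩
    p + (eₘ + t * (⟦ m ⟧ * eₘ))       ≈⟨ +-congˡ (+-cong (*-identityˡ eₘ) (*-assoc _ _ _)) ⟨
    p + (1# * eₘ + t * ⟦ m ⟧ * eₘ)    ≈⟨ +-congˡ (trans (*-congʳ (⟦⟧-suc m)) (distribʳ _ _ _)) ⟨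
    p + ⟦ suc m ⟧ * eₘ               ≈⟨ +-congˡ (H-coeff x (suc m)) ⟨
    p + B.H (scaled x) (suc m)      ≈⟨ B.E≈P+H (scaled x) (suc m) ⟨
    B.E (scaled x) (suc m)          ≈⟨ E-coeff x (suc m) ⟩
    eₘ                               ≈⟨ +-identityˡ eₘ ⟨
    0# + eₘ                          ∎))
    where
    eₘ = e⟨ suc m ⟩ x
    p = B.P (scaled x) (suc m)

  -- Rotations carry colour `j` down to the bottom, where `first-return` applies. The number `d` is
  -- there for termination, since `inject₁ j` is not a subterm of `suc j`.
  denominator-closed : ∀ (x : Vector Carrier (suc n)) j d → toℕ j ≡ d →
                       denominator x ⊛ closed x j ≋ denominator (removeAt x j)
  denominator-closed x zero    d       eq m = begin
    (denominator x ⊛ closed x zero) m    ≈⟨ ⊛-cong {g = closed x zero} (P-coeff x) (λ _ → refl) m ⟨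
    (B.P (scaled x) ⊛ closed x zero) m   ≈⟨ B.first-return (scaled x) (walks x zero) (walks-equation x zero) m ⟩
    B.P (scaled (tail x)) m              ≈⟨ P-coeff (tail x) m ⟩
    denominator (tail x) m               ∎
  denominator-closed x (suc j) (suc d) eq m = begin
    (denominator x ⊛ closed x (suc j)) m
      ≈⟨ ⊛-cong (denominator-cong λ k → sym (e-rotate k x)) (closed-rotate x j) m ⟩
    (denominator (rotate x) ⊛ closed (rotate x) (inject₁ j)) m
      ≈⟨ denominator-closed (rotate x) (inject₁ j) d (≡.trans (toℕ-inject₁ j) (suc-injective eq)) m ⟩
    denominator (removeAt (rotate x) (inject₁ j)) m
      ≈⟨ denominator-cong (λ k → e-remove-rotate k x j) m ⟩
    denominator (removeAt x (suc j)) m ∎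

  -- The empty walks would add the number of colours to the trace, a constant term that no cycle
  -- accounts for.
  closed⁺ : Vector Carrier n → Fin n → Series
  closed⁺ x j zero    = 0#
  closed⁺ x j (suc m) = closed x j (suc m)

  unit-diagonal : (j : Fin n) → unit j j ≈ 1#
  unit-diagonal zero    = refl
  unit-diagonal (suc j) = unit-diagonal j

  -- Removing the empty walk subtracts the denominator of `x` from that of `removeAt x j`; by
  -- `e-remove` the difference of the elementary polynomials is the part divisible by `x j`.
  denominator-closed⁺ : ∀ (x : Vector Carrier (suc n)) j m →
                        (denominator x ⊛ closed⁺ x j) (suc m) ≈ t * (⟦ m ⟧ * (x j * e⟨ m ⟩ (removeAt x j)))
  denominator-closed⁺ x j m = +-cancelʳ (D (suc m)) _ _ (begin
    (D ⊛ C) (suc m) + D (suc m)                    ≈⟨ +-congˡ (S.*-identityʳ D (suc m)) ⟨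
    ((D ⊛ C) ⊕ (D ⊛ 𝟙)) (suc m)                    ≈⟨ S.distribˡ D C 𝟙 (suc m) ⟨
    (D ⊛ (C ⊕ 𝟙)) (suc m)                          ≈⟨ ⊛-cong {D} (λ _ → refl) C+1 (suc m) ⟩
    (D ⊛ closed x j) (suc m)                       ≈⟨ denominator-closed x j (toℕ j) ≡.refl (suc m) ⟩
    - (t * (k * e⟨ suc m ⟩ (removeAt x j)))        ≈⟨ sym (trans (+-congˡ (-‿cong s)) cancel) ⟩
    t * (k * b) + - (t * (k * e⟨ suc m ⟩ x))       ∎)
    where
    D = denominator x
    C = closed⁺ x j
    k = ⟦ m ⟧
    a = e⟨ suc m ⟩ (removeAt x j)
    b = x j * e⟨ m ⟩ (removeAt x j)

    C+1 : C ⊕ 𝟙 ≋ closed x j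
    C+1 zero    = trans (+-identityˡ 1#) (sym (unit-diagonal j))
    C+1 (suc i) = +-identityʳ _

    s : t * (k * e⟨ suc m ⟩ x) ≈ t * (k * a) + t * (k * b)
    s = trans (*-congˡ (*-congˡ (e-remove m x j))) (solve 4 (λ t k a b → t :* (k :* (a :+ b)) := t :* (k :* a) :+ t :* (k :* b)) refl _ _ _ _)

    cancel : t * (k * b) + - (t * (k * a) + t * (k * b)) ≈ - (t * (k * a))
    cancel = -‿unique _ _ (begin
      t * (k * b) + - (t * (k * a) + t * (k * b)) + t * (k * a)
        ≈⟨ solve 3 (λ p q r → p :+ q :+ r := q :+ (r :+ p)) refl _ _ _ ⟩
      - (t * (k * a) + t * (k * b)) + (t * (k * a) + t * (k * b))
        ≈⟨ -‿inverseˡ _ ⟩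
      0# ∎)

  trace : Vector Carrier n → Series
  trace x m = sum λ j → closed⁺ x j m

  sum-coeff : ∀ (f : Vector Series n) m → B.sum f m ≈ sum (λ j → f j m)
  sum-coeff {zero}  f m = refl
  sum-coeff {suc n} f m = +-congˡ (sum-coeff (tail f) m)

  denominator-trace : (x : Vector Carrier n) → denominator x ⊛ trace x ≋ numerator x
  denominator-trace {n}     x zero    = trans (+-identityʳ _) (trans (*-identityˡ _) (sum-replicate-zero n))
  denominator-trace {zero}  x (suc m) = trans (S.zeroʳ (denominator x) (suc m))
    (sym (trans (*-congˡ (trans (*-congˡ (×-0# (suc m))) (zeroʳ _))) (zeroʳ t)))
  denominator-trace {suc n} x (suc m) = begin
    (denominator x ⊛ trace x) (suc m)
      ≈⟨ ⊛-cong {denominator x} (λ _ → refl) (λ i → sym (sum-coeff (closed⁺ x) i)) (suc m) ⟩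
    (denominator x ⊛ B.sum (closed⁺ x)) (suc m)
      ≈⟨ SΣ.*-distribˡ-sum (denominator x) (closed⁺ x) (suc m) ⟩
    B.sum (λ j → denominator x ⊛ closed⁺ x j) (suc m)
      ≈⟨ sum-coeff (λ j → denominator x ⊛ closed⁺ x j) (suc m) ⟩
    sum (λ j → (denominator x ⊛ closed⁺ x j) (suc m))
      ≈⟨ sum-cong-≋ (λ j → denominator-closed⁺ x j m) ⟩
    sum (λ j → t * (⟦ m ⟧ * (x j * e⟨ m ⟩ (removeAt x j))))
      ≈⟨ *-distribˡ-sum t (λ j → ⟦ m ⟧ * (x j * e⟨ m ⟩ (removeAt x j))) ⟨
    t * sum (λ j → ⟦ m ⟧ * (x j * e⟨ m ⟩ (removeAt x j)))
      ≈⟨ *-congˡ (trans (*-congˡ (sym (sum≈∙ x (λ j → e⟨ m ⟩ (removeAt x j))))) (*-distribˡ-sum ⟦ m ⟧ (λ j → x j * e⟨ m ⟩ (removeAt x j)))) ⟨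
    t * (⟦ m ⟧ * (x ∙ (λ j → e⟨ m ⟩ (removeAt x j))))
      ≈⟨ *-congˡ (*-congˡ (∑-e-remove m x)) ⟩
    t * (⟦ m ⟧ * (suc m · e⟨ suc m ⟩ x)) ∎

-- Closed walks as coloured cycles

next-inject₁ : ∀ {m} (i : Fin m) → next (inject₁ i) ≡ suc i
next-inject₁ {m} i = toℕ-injective (≡.trans (toℕ-fromℕ< _) (≡.trans
  (m<n⇒m%n≡m (≡.subst (λ k → suc k ℕ.< suc m) (≡.sym (toℕ-inject₁ i)) (s≤s (toℕ<n i))))
  (≡.cong suc (toℕ-inject₁ i))))

next-fromℕ : ∀ m → next (fromℕ m) ≡ zero
next-fromℕ m = toℕ-injective (≡.trans (toℕ-fromℕ< _) (≡.trans
  (≡.cong (λ k → suc k ℕ.% suc m) (toℕ-fromℕ m)) (n%n≡0 (suc m))))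

module Words {r ℓ} (R : CommutativeRing r ℓ) (t : CommutativeRing.Carrier R) where
  open CommutativeRing R hiding (zero)
  open Transfer R t
  open MonoidSum *-monoid using () renaming (sum to product; sum-init-last to product-init-last; sum-cong-≋ to product-cong)
  open MonoidSum +-monoid using (sum-cong-≋; sum-replicate-zero)
  open CommutativeMonoidSum +-commutativeMonoid using (∑-distrib-+)
  open SetoidReasoning setoid
  open SemiringSolver commutativeSemiring using (solve; _:+_; _:*_; _:=_)

  private variable
    n : ℕ
    A B C : Set

  Σ[_] : List A → (A → Carrier) → Carrier
  Σ[ xs ] f = foldr (λ x s → f x + s) 0# xs

  Σ-cong : ∀ (xs : List A) {f g : A → Carrier} → (∀ x → f x ≈ g x) → Σ[ xs ] f ≈ Σ[ xs ] g
  Σ-cong []       p = refl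
  Σ-cong (x ∷ xs) p = +-cong (p x) (Σ-cong xs p)

  Σ-++ : ∀ (xs ys : List A) f → Σ[ xs ++ ys ] f ≈ Σ[ xs ] f + Σ[ ys ] f
  Σ-++ []       ys f = sym (+-identityˡ _)
  Σ-++ (x ∷ xs) ys f = trans (+-congˡ (Σ-++ xs ys f)) (sym (+-assoc _ _ _))

  Σ-map : ∀ (h : A → B) xs f → Σ[ map h xs ] f ≈ Σ[ xs ] (f ∘ h)
  Σ-map h []       f = refl
  Σ-map h (x ∷ xs) f = +-congˡ (Σ-map h xs f)

  Σ-cartesian : ∀ (h : A → B → C) xs ys f →
                Σ[ cartesianProductWith h xs ys ] f ≈ Σ[ xs ] (λ x → Σ[ ys ] (λ y → f (h x y)))
  Σ-cartesian h []       ys f = refl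
  Σ-cartesian h (x ∷ xs) ys f = trans (Σ-++ (map (h x) ys) _ f) (+-cong (Σ-map (h x) ys f) (Σ-cartesian h xs ys f))

  Σ-tabulate : ∀ (h : Fin n → A) f → Σ[ tabulate h ] f ≈ sum (f ∘ h)
  Σ-tabulate {zero}  h f = refl
  Σ-tabulate {suc n} h f = +-congˡ (Σ-tabulate (h ∘ suc) f)

  Σ-scale : ∀ c (xs : List A) f → c * Σ[ xs ] f ≈ Σ[ xs ] (λ x → c * f x)
  Σ-scale c []       f = zeroʳ c
  Σ-scale c (x ∷ xs) f = trans (distribˡ _ _ _) (+-congˡ (Σ-scale c xs f))

  sum-Σ-swap : ∀ (xs : List A) (f : Fin n → A → Carrier) →
               sum (λ j → Σ[ xs ] (f j)) ≈ Σ[ xs ] (λ x → sum (λ j → f j x))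
  sum-Σ-swap {n = n} []       f = sum-replicate-zero n
  sum-Σ-swap         (x ∷ xs) f = trans (∑-distrib-+ (λ j → f j x) (λ j → Σ[ xs ] (f j))) (+-congˡ (sum-Σ-swap xs f))

  sum-unit : ∀ (f : Fin n → Carrier) l → sum (λ j → f j * unit j l) ≈ f l
  sum-unit {suc n} f zero = trans (+-cong (*-identityʳ _) (trans (sum-cong-≋ {n} (λ j → zeroʳ (f (suc j)))) (sum-replicate-zero n))) (+-identityʳ _)
  sum-unit f (suc l) = trans (+-cong (zeroʳ _) (sum-unit (f ∘ suc) l)) (+-identityˡ _)

  w : Fin n → Fin n → Carrier
  w zero    zero    = 0#
  w zero    (suc k) = t
  w (suc i) zero    = 1#
  w (suc i) (suc k) = w i k

  M≈sum : ∀ (x y : Vector Carrier n) i → M x y i ≈ sum (λ k → w i k * (x k * y k))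
  M≈sum {suc n} x y zero = begin
    t * (tail x ∙ tail y) ≈⟨ *-congˡ (sum≈∙ (tail x) (tail y)) ⟨
    t * sum (λ k → tail x k * tail y k) ≈⟨ SemiringSum.*-distribˡ-sum semiring t (λ k → tail x k * tail y k) ⟩
    sum (λ k → t * (tail x k * tail y k)) ≈⟨ +-identityˡ _ ⟨
    0# + sum (λ k → t * (tail x k * tail y k)) ≈⟨ +-congʳ (zeroˡ _) ⟨
    0# * (x zero * y zero) + sum (λ k → t * (tail x k * tail y k)) ∎
  M≈sum {suc n} x y (suc i) = +-cong (sym (*-identityˡ _)) (M≈sum (tail x) (tail y) i)

  M-unit-diagonal : ∀ (x : Vector Carrier n) j → M x (unit j) j ≈ 0#
  M-unit-diagonal x zero    = trans (*-congˡ (zeros (tail x))) (zeroʳ t)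
    where
    zeros : ∀ {n} (x : Vector Carrier n) → x ∙ (λ _ → 0#) ≈ 0#
    zeros {zero}  x = refl
    zeros {suc n} x = trans (+-cong (zeroʳ _) (zeros (tail x))) (+-identityʳ 0#)
  M-unit-diagonal x (suc j) = trans (+-cong (zeroʳ _) (M-unit-diagonal (tail x) j)) (+-identityʳ 0#)

  Π[_] : List A → (A → Carrier) → Carrier
  Π[ xs ] f = foldr (λ x s → f x * s) 1# xs

  Π-tabulate : ∀ {m} (h : Fin m → A) f → Π[ tabulate h ] f ≈ product (f ∘ h)
  Π-tabulate {m = zero}  h f = refl
  Π-tabulate {m = suc m} h f = *-congˡ (Π-tabulate (h ∘ suc) f)

  edgeWeight : ∀ {m} → Vec (Fin n) m → Fin m × Fin m → Carrier
  edgeWeight κ (u , v) = w (lookup κ u) (lookup κ v)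

  module _ (x : Vector Carrier n) where

    path : ∀ {m} → Fin n → Vec (Fin n) m → Carrier
    path i []      = 1#
    path i (k ∷ κ) = w i k * (x k * path k κ)

    end : ∀ {m} → Fin n → Vec (Fin n) m → Fin n
    end i []      = i
    end i (k ∷ κ) = end k κ

    walk≈Σpaths : ∀ m y i → walk x m y i ≈ Σ[ colourings n m ] (λ κ → path i κ * y (end i κ))
    walk≈Σpaths zero    y i = sym (trans (+-identityʳ _) (*-identityˡ _))
    walk≈Σpaths (suc m) y i = begin
      M x (walk x m y) i
        ≈⟨ M≈sum x (walk x m y) i ⟩
      sum (λ k → w i k * (x k * walk x m y k))
        ≈⟨ sum-cong-≋ (λ k → trans (*-congˡ (trans (*-congˡ (walk≈Σpaths m y k)) (Σ-scale (x k) ys _))) (Σ-scale (w i k) ys _)) ⟩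
      sum (λ k → Σ[ ys ] (λ κ → w i k * (x k * (path k κ * y (end k κ)))))
        ≈⟨ sum-cong-≋ {n} (λ k → Σ-cong ys (λ κ →
             solve 4 (λ a b c d → a :* (b :* (c :* d)) := a :* (b :* c) :* d) refl (w i k) (x k) (path k κ) (y (end k κ)))) ⟩
      sum (λ k → Σ[ ys ] (λ κ → path i (k ∷ κ) * y (end k κ)))
        ≈⟨ Σ-tabulate {n} id (λ k → Σ[ ys ] (λ κ → path i (k ∷ κ) * y (end k κ))) ⟨
      Σ[ allFin n ] (λ k → Σ[ ys ] (λ κ → path i (k ∷ κ) * y (end k κ)))
        ≈⟨ Σ-cartesian _∷_ (allFin n) ys (λ κ → path i κ * y (end i κ)) ⟨
      Σ[ colourings n (suc m) ] (λ κ → path i κ * y (end i κ)) ∎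
      where ys = colourings n m

    monomial : ∀ {m} → Vec (Fin n) m → Carrier
    monomial []      = 1#
    monomial (k ∷ κ) = x k * monomial κ

    path≈product : ∀ {m} k (κ : Vec (Fin n) m) →
                   path k κ ≈ product (λ i → w (lookup (k ∷ κ) (inject₁ i)) (lookup κ i)) * monomial κ
    path≈product k []      = sym (*-identityˡ 1#)
    path≈product k (l ∷ κ) = trans (*-congˡ (*-congˡ (path≈product l κ)))
      (solve 4 (λ a b c d → a :* (b :* (c :* d)) := a :* c :* (b :* d)) refl _ _ _ _)

    end≡last : ∀ {m} k (κ : Vec (Fin n) m) → end k κ ≡ lookup (k ∷ κ) (fromℕ m)
    end≡last k []      = ≡.refl
    end≡last k (l ∷ κ) = end≡last l κ

    -- The walk starts at its own end, so its first step is the edge that closes the cycle. That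
    -- edge stands last in the edge list, whence the product is split at its last factor.
    cyclic-path : ∀ {m} k (κ : Vec (Fin n) m) →
                  path (end k κ) (k ∷ κ) ≈ Π[ edges (cycle (suc m)) ] (edgeWeight (k ∷ κ)) * monomial (k ∷ κ)
    cyclic-path {m} k κ = begin
      w (end k κ) k * (x k * path k κ) ≈⟨ *-congˡ (*-congˡ (path≈product k κ)) ⟩
      w (end k κ) k * (x k * (product ws * monomial κ))
        ≈⟨ solve 4 (λ a b c d → a :* (b :* (c :* d)) := c :* a :* (b :* d)) refl _ _ _ _ ⟩
      product ws * w (end k κ) k * (x k * monomial κ)
        ≈⟨ *-congʳ (*-cong
             (product-cong (λ i → reflexive
               (≡.cong (w (lookup (k ∷ κ) (inject₁ i)) ∘ lookup (k ∷ κ)) (≡.sym (next-inject₁ i)))))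
             (reflexive (≡.cong₂ w (end≡last k κ) (≡.cong (lookup (k ∷ κ)) (≡.sym (next-fromℕ m)))))) ⟩
      product (λ i → cw (inject₁ i)) * cw (fromℕ m) * (x k * monomial κ)
        ≈⟨ *-congʳ (product-init-last cw) ⟨
      product cw * (x k * monomial κ)
        ≈⟨ *-congʳ (Π-tabulate (λ i → i , next i) (edgeWeight (k ∷ κ))) ⟨
      Π[ edges (cycle (suc m)) ] (edgeWeight (k ∷ κ)) * monomial (k ∷ κ) ∎
      where
      ws : Vector Carrier m
      ws i = w (lookup (k ∷ κ) (inject₁ i)) (lookup κ i)
      cw : Vector Carrier (suc m)
      cw i = edgeWeight (k ∷ κ) (i , next i)

    sum-closed : ∀ m → sum (λ j → closed x j (suc m)) ≈
                 Σ[ colourings n (suc m) ] (λ κ → Π[ edges (cycle (suc m)) ] (edgeWeight κ) * monomial κ)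
    sum-closed m = begin
      sum (λ j → walk x (suc m) (unit j) j)
        ≈⟨ sum-cong-≋ (λ j → walk≈Σpaths (suc m) (unit j) j) ⟩
      sum (λ j → Σ[ colourings n (suc m) ] (λ κ → path j κ * unit j (end j κ)))
        ≈⟨ sum-Σ-swap (colourings n (suc m)) (λ j κ → path j κ * unit j (end j κ)) ⟩
      Σ[ colourings n (suc m) ] (λ κ → sum (λ j → path j κ * unit j (end j κ)))
        -- The end of a nonempty word does not depend on the start `j`, so the unit vector selects
        -- the single start equal to it.
        ≈⟨ Σ-cong (colourings n (suc m)) (λ { (k ∷ κ) → trans (sum-unit (λ j → path j (k ∷ κ)) (end k κ)) (cyclic-path k κ) }) ⟩
      Σ[ colourings n (suc m) ] (λ κ → Π[ edges (cycle (suc m)) ] (edgeWeight κ) * monomial κ) ∎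

-- Coefficients of closed walks and of elementary symmetric functions

module Slices (N : ℕ) = PowerSeriesProperties Ring[ N ]

T[_] : ℕ → CommutativeRing 0ℓ 0ℓ
T[ N ] = Slices.commutativeRing N

module TR (N : ℕ) = CommutativeRing T[ N ]

-- Inverse to `slice` up to `≈[ suc N ]`, which compares nonempty lists only; `0ℤ` is a default
-- value.
unslice : (ℕ → X.Carrier) → X.Carrier
unslice F []      = 0ℤ
unslice F (a ∷ α) = F a α

xvar : ∀ {N} → Vector X.Carrier N
xvar zero    = unslice T-series.var
xvar (suc c) = unslice (T-series.const (xvar c))

module _ {N : ℕ} where
  open Slices N using (_⊛_; const-⊛; var-⊛-zero; var-⊛-suc)
  private module R₀ = R N

  embed : X.Carrier → X.Carrier
  embed f = unslice (T-series.const f)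

  embed-⊛ : ∀ f g a → slice (embed f X.* g) a ≈[ N ] (f X.* slice g a)
  embed-⊛ f g a = R₀.trans (slice-* N (embed f) g a) (const-⊛ f (slice g) a)

  xvar-⊛-zero : ∀ g → slice (xvar {suc N} zero X.* g) 0 ≈[ N ] X.0#
  xvar-⊛-zero g = R₀.trans (slice-* N (xvar {suc N} zero) g 0) (var-⊛-zero (slice g))

  xvar-⊛-suc : ∀ g a → slice (xvar {suc N} zero X.* g) (suc a) ≈[ N ] slice g a
  xvar-⊛-suc g a = R₀.trans (slice-* N (xvar {suc N} zero) g (suc a)) (var-⊛-suc (slice g) a)

  embed-+ : ∀ f g → embed (f X.+ g) ≈[ suc N ] (embed f X.+ embed g)
  embed-+ f g = slices≈ {N} λ { zero → on λ _ _ → ≡.refl ; (suc _) → on λ _ _ → ≡.refl }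

  embed-* : ∀ f g → embed (f X.* g) ≈[ suc N ] (embed f X.* embed g)
  embed-* f g = slices≈ {N} λ
    { zero    → R₀.sym (embed-⊛ f (embed g) 0)
    ; (suc a) → R₀.sym (R₀.trans (embed-⊛ f (embed g) (suc a)) (R₀.zeroʳ f)) }

module eX (N : ℕ) = Transfer Ring[ N ] X.0#

e-embed : ∀ {N n} k (x : Vector X.Carrier n) → eX.e⟨_⟩ (suc N) k (embed {N} ∘ x) ≈[ suc N ] embed {N} (eX.e⟨_⟩ N k x)
e-embed {N} zero x = slices≈ λ { zero → on λ _ _ → ≡.refl ; (suc _) → on λ _ _ → ≡.refl }
e-embed {N} {zero} (suc k) x = slices≈ λ { zero → on λ _ _ → ≡.refl ; (suc _) → on λ _ _ → ≡.refl }
e-embed {N} {suc n} (suc k) x = begin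
  e⁺⟨ suc k ⟩ (embed {N} ∘ tail x) X.+ embed {N} (x zero) X.* e⁺⟨ k ⟩ (embed {N} ∘ tail x)
    ≈⟨ R₁.+-cong (e-embed (suc k) (tail x)) (R₁.*-cong (R₁.refl {embed {N} (x zero)}) (e-embed k (tail x))) ⟩
  embed {N} (e⟨ suc k ⟩ (tail x)) X.+ embed {N} (x zero) X.* embed {N} (e⟨ k ⟩ (tail x))
    ≈⟨ R₁.+-cong (R₁.refl {embed {N} (e⟨ suc k ⟩ (tail x))}) (embed-* (x zero) (e⟨ k ⟩ (tail x))) ⟨
  embed {N} (e⟨ suc k ⟩ (tail x)) X.+ embed {N} (x zero X.* e⟨ k ⟩ (tail x))
    ≈⟨ embed-+ (e⟨ suc k ⟩ (tail x)) (x zero X.* e⟨ k ⟩ (tail x)) ⟨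
  embed {N} (e⟨ suc k ⟩ x) ∎
  where
  module R₁ = R (suc N)
  open eX N using (e⟨_⟩)
  open eX (suc N) using () renaming (e⟨_⟩ to e⁺⟨_⟩)
  open SetoidReasoning R₁.setoid

e-zero : ∀ α → X.1# α ≡ e 0 α
e-zero []                = ≡.refl
e-zero (0 ∷ α)           = e-zero α
e-zero (1 ∷ α)           with does (all? (_≤? 1) α)
... | true  = ≡.refl
... | false = ≡.refl
e-zero (suc (suc a) ∷ α) = ≡.refl

-- Sorted by the exponent of the first variable: exponent 0 leaves degree `suc k` to the others,
-- exponent 1 leaves degree `k`, and a higher exponent is not squarefree.
e-xvar : ∀ N k → eX.e⟨_⟩ N k (xvar {N}) ≈[ N ] e k
e-xvar N       zero    = on λ α _ → e-zero α
e-xvar zero    (suc k) = on λ { [] _ → ≡.refl }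
e-xvar (suc N) (suc k) = slices≈ λ
  { zero          → R₀.trans (R₀.+-cong (R₀.trans (lower (suc k) 0) (e-xvar N (suc k))) (xvar-⊛-zero g))
                      (R₀.trans (R₀.+-identityʳ _) (on λ _ _ → ≡.refl))
  ; (suc zero)    → R₀.trans (R₀.+-cong (lower (suc k) 1)
                        (R₀.trans (xvar-⊛-suc g 0) (R₀.trans (lower k 0) (e-xvar N k))))
                      (R₀.trans (R₀.+-identityˡ _) (on λ _ _ → ≡.refl))
  ; (suc (suc a)) → R₀.trans (R₀.+-cong (lower (suc k) (2 ℕ.+ a))
                        (R₀.trans (xvar-⊛-suc g (suc a)) (lower k (suc a))))
                      (R₀.trans (R₀.+-identityˡ _) (on λ _ _ → ≡.refl)) }
  where
  module R₀ = R N
  g = eX.e⟨_⟩ (suc N) k (embed {N} ∘ xvar {N})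
  lower : ∀ k a → slice (eX.e⟨_⟩ (suc N) k (embed {N} ∘ xvar {N})) a ≈[ N ] T-series.const (eX.e⟨_⟩ N k (xvar {N})) a
  lower k a = on λ α l → at (e-embed {N} k xvar) (a ∷ α) (≡.cong suc l)

δ : Monomial → X.Carrier
δ β α = if does (≡-dec _≟_ β α) then 1ℤ else 0ℤ

slice-δ : ∀ {N} b β a → slice (δ (b ∷ β)) a ≈[ N ] (if does (b ≟ a) then δ β else X.0#)
slice-δ b β a = on λ α _ → lemma α
  where
  lemma : ∀ α → slice (δ (b ∷ β)) a α ≡ (if does (b ≟ a) then δ β else X.0#) α
  lemma α with does (b ≟ a)
  ... | true  = ≡.refl
  ... | false = ≡.refl

bump : ∀ {N} → Fin N → Monomial → Monomial
bump c       []      = []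
bump zero    (b ∷ β) = suc b ∷ β
bump (suc c) (b ∷ β) = b ∷ bump c β

xvar-δ : ∀ {N} (c : Fin N) β → length β ≡ N → (xvar c X.* δ β) ≈[ N ] δ (bump c β)
xvar-δ {suc N} zero    (b ∷ β) l = slices≈ λ
  { zero    → R.trans N (xvar-⊛-zero (δ (b ∷ β))) (on λ _ _ → ≡.refl)
  ; (suc a) → R.trans N (xvar-⊛-suc (δ (b ∷ β)) a) (on λ _ _ → ≡.refl) }
xvar-δ {suc N} (suc c) (b ∷ β) l = slices≈ λ a → begin
  slice (xvar (suc c) X.* δ (b ∷ β)) a               ≈⟨ embed-⊛ (xvar c) (δ (b ∷ β)) a ⟩
  xvar c X.* slice (δ (b ∷ β)) a                     ≈⟨ R₀.*-cong (R₀.refl {xvar c}) (slice-δ b β a) ⟩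
  xvar c X.* (if does (b ≟ a) then δ β else X.0#)    ≈⟨ under-if (does (b ≟ a)) ⟩
  (if does (b ≟ a) then δ (bump c β) else X.0#)      ≈⟨ slice-δ b (bump c β) a ⟨
  slice (δ (b ∷ bump c β)) a                         ∎
  where
  module R₀ = R N
  open SetoidReasoning R₀.setoid
  under-if : ∀ d → (xvar c X.* (if d then δ β else X.0#)) ≈[ N ] (if d then δ (bump c β) else X.0#)
  under-if true  = xvar-δ c β (suc-injective l)
  under-if false = R₀.zeroʳ (xvar c)

bump-tabulate : ∀ {N} (k : Fin N) (f : Fin N → ℕ) →
                tabulate (λ c → (if does (c Fin.≟ k) then suc else id) (f c)) ≡ bump k (tabulate f)
bump-tabulate zero    f = ≡.refl
bump-tabulate (suc k) f = ≡.cong (f zero ∷_) (bump-tabulate k (f ∘ suc))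

content-∷ : ∀ {N n} k (κ : Colouring N n) → content (k ∷ κ) ≡ bump k (content κ)
content-∷ k κ = bump-tabulate k (λ c → Vec.count (c Fin.≟_) κ)

1≈δ : ∀ N → X.1# ≈[ N ] δ (tabulate {n = N} (λ _ → 0))
1≈δ zero    = on λ { [] _ → ≡.refl }
1≈δ (suc N) = slices≈ λ { zero → R.trans N (1≈δ N) (on λ _ _ → ≡.refl) ; (suc a) → on λ _ _ → ≡.refl }

-- The term tᵃ x^β, in a form whose coefficients are the indicators that `chromatic` counts.
tx : ℕ → Monomial → T.Carrier
tx a β j = if does (a ≟ j) then δ β else X.0#

length-filter-∷ : ∀ {A : Set} {P : A → Set} (P? : Decidable P) x xs →
                  length (filter P? (x ∷ xs)) ≡ (if does (P? x) then suc else id) (length (filter P? xs))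
length-filter-∷ P? x xs with does (P? x)
... | true  = ≡.refl
... | false = ≡.refl

module _ (N : ℕ) where
  open Slices N using (const-⊛; var-⊛-zero; var-⊛-suc; _≋_)
  open Words T[ N ] t
  open SetoidReasoning (TR.setoid N)
  private
    module T₀ = TR N
    module R₀ = R N

  xᵀ : Vector T.Carrier N
  xᵀ c = T-series.const (xvar c)

  t-tx : ∀ a β → t T.* tx a β ≋ tx (suc a) β
  t-tx a β zero    = var-⊛-zero (tx a β)
  t-tx a β (suc j) = R₀.trans (var-⊛-suc (tx a β) j) (on λ _ _ → ≡.refl)

  x-tx : ∀ c a β → length β ≡ N → xᵀ c T.* tx a β ≋ tx a (bump c β)
  x-tx c a β l j = R₀.trans (const-⊛ (xvar c) (tx a β) j) (under-if (does (a ≟ j)))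
    where
    under-if : ∀ d → (xvar c X.* (if d then δ β else X.0#)) ≈[ N ] (if d then δ (bump c β) else X.0#)
    under-if true  = xvar-δ c β l
    under-if false = R₀.zeroʳ (xvar c)

  monomial≈tx : ∀ {m} (κ : Colouring N m) → monomial xᵀ κ ≋ tx 0 (content κ)
  monomial≈tx []      zero    = 1≈δ N
  monomial≈tx []      (suc j) = R₀.refl
  monomial≈tx (k ∷ κ) = begin
    xᵀ k T.* monomial xᵀ κ      ≈⟨ T₀.*-cong (T₀.refl {xᵀ k}) (monomial≈tx κ) ⟩
    xᵀ k T.* tx 0 (content κ)   ≈⟨ x-tx k 0 (content κ) (length-tabulate (λ c → Vec.count (c Fin.≟_) κ)) ⟩
    tx 0 (bump k (content κ))   ≡⟨ ≡.cong (tx 0) (content-∷ k κ) ⟨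
    tx 0 (content (k ∷ κ))      ∎

  w-tx : ∀ {n} (i k : Fin n) a β →
         w i k T.* tx a β ≋ (if does (¬? (i Fin.≟ k)) then tx ((if does (i Fin.<? k) then suc else id) a) β else T.0#)
  w-tx zero    zero    a β = T₀.zeroˡ (tx a β)
  w-tx zero    (suc k) a β = t-tx a β
  w-tx (suc i) zero    a β = T₀.*-identityˡ (tx a β)
  w-tx (suc i) (suc k) a β = w-tx i k a β

  module _ {n m} (κ : Vec (Fin n) m) (β : Monomial) where
    proper-on? : (es : List (Fin m × Fin m)) → Dec _
    proper-on? es = all? (λ (u , v) → ¬? (lookup κ u Fin.≟ lookup κ v)) es

    asc-on : List (Fin m × Fin m) → ℕ
    asc-on es = length (filter (λ (u , v) → lookup κ u Fin.<? lookup κ v) es)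

    -- Every edge either kills the term, raises its power of t, or leaves it alone. Properness and
    -- ascents are taken over an arbitrary edge list so that the induction can peel edges off.
    Π-tx : ∀ es → Π[ es ] (edgeWeight κ) T.* tx 0 β ≋ (if does (proper-on? es) then tx (asc-on es) β else T.0#)
    Π-tx []             = T₀.*-identityˡ (tx 0 β)
    Π-tx ((u , v) ∷ es) = begin
      (edgeWeight κ (u , v) T.* Π[ es ] (edgeWeight κ)) T.* tx 0 β
        ≈⟨ T₀.*-assoc (edgeWeight κ (u , v)) (Π[ es ] (edgeWeight κ)) (tx 0 β) ⟩
      edgeWeight κ (u , v) T.* (Π[ es ] (edgeWeight κ) T.* tx 0 β)
        ≈⟨ T₀.*-cong (T₀.refl {edgeWeight κ (u , v)}) (Π-tx es) ⟩
      edgeWeight κ (u , v) T.* (if does (proper-on? es) then tx (asc-on es) β else T.0#)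
        ≈⟨ under-if (does (proper-on? es)) ⟩
      (if does (¬? (lookup κ u Fin.≟ lookup κ v)) ∧ does (proper-on? es)
       then tx ((if does (lookup κ u Fin.<? lookup κ v) then suc else id) (asc-on es)) β else T.0#)
        ≡⟨ ≡.cong (λ a → if does (proper-on? ((u , v) ∷ es)) then tx a β else T.0#)
             (length-filter-∷ (λ (u , v) → lookup κ u Fin.<? lookup κ v) (u , v) es) ⟨
      (if does (proper-on? ((u , v) ∷ es)) then tx (asc-on ((u , v) ∷ es)) β else T.0#) ∎
      where
      f = if does (lookup κ u Fin.<? lookup κ v) then suc else id
      under-if : ∀ p → edgeWeight κ (u , v) T.* (if p then tx (asc-on es) β else T.0#) ≋
                 (if does (¬? (lookup κ u Fin.≟ lookup κ v)) ∧ p then tx (f (asc-on es)) β else T.0#)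
      under-if true  = T₀.trans (w-tx (lookup κ u) (lookup κ v) (asc-on es) β) (T₀.reflexive (if-∧-true (does (¬? (lookup κ u Fin.≟ lookup κ v)))))
        where
        if-∧-true : ∀ q → (if q then tx (f (asc-on es)) β else T.0#) ≡ (if q ∧ true then tx (f (asc-on es)) β else T.0#)
        if-∧-true true  = ≡.refl
        if-∧-true false = ≡.refl
      under-if false = T₀.trans (T₀.zeroʳ (edgeWeight κ (u , v))) (T₀.reflexive (if-∧-false (does (¬? (lookup κ u Fin.≟ lookup κ v)))))
        where
        if-∧-false : ∀ q → T.0# ≡ (if q ∧ false then tx (f (asc-on es)) β else T.0#)
        if-∧-false true  = ≡.refl
        if-∧-false false = ≡.refl

count-filter : ∀ {A : Set} {P : A → Set} (P? : Decidable P) xs →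
               + length (filter P? xs) ≡ foldr (λ x s → (if does (P? x) then 1ℤ else 0ℤ) ℤ.+ s) 0ℤ xs
count-filter P? []       = ≡.refl
count-filter P? (x ∷ xs) = ≡.trans (≡.cong +_ (length-filter-∷ P? x xs)) (≡.trans (lemma (does (P? x)))
  (≡.cong (λ s → (if does (P? x) then 1ℤ else 0ℤ) ℤ.+ s) (count-filter P? xs)))
  where
  lemma : ∀ b → + (if b then suc else id) (length (filter P? xs)) ≡ (if b then 1ℤ else 0ℤ) ℤ.+ (+ length (filter P? xs))
  lemma true  = ≡.refl
  lemma false = ≡.refl

weight : ∀ N {m} → Colouring N (suc m) → T.Carrier
weight N {m} κ = Π[ edges (cycle (suc m)) ] (edgeWeight κ) T.* monomial (xᵀ N) κ
  where open Words T[ N ] t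

weight-coeff : ∀ m j α (κ : Colouring (length α) (suc m)) →
  (if does (proper? (cycle (suc m)) κ ×-dec asc (cycle (suc m)) κ ≟ j ×-dec ≡-dec _≟_ (content κ) α) then 1ℤ else 0ℤ)
  ≡ weight (length α) κ j α
weight-coeff m j α κ = ≡.sym (≡.trans
  (at (TR.trans N (TR.*-cong N (TR.refl N {Π[ es ] (edgeWeight κ)}) (monomial≈tx N κ)) (Π-tx N κ (content κ) es) j) α ≡.refl)
  (lemma (does (proper? (cycle (suc m)) κ)) (asc (cycle (suc m)) κ ≟ j)))
  where
  N  = length α
  es = edges (cycle (suc m))
  open Words T[ N ] t
  lemma : ∀ p {a} (d : Dec (a ≡ j)) → (if p then tx a (content κ) else T.0#) j α ≡
          (if p ∧ (does (a ≟ j) ∧ does (≡-dec _≟_ (content κ) α)) then 1ℤ else 0ℤ)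
  lemma false     d = ≡.refl
  lemma true  {a} _ with does (a ≟ j)
  ... | true  = ≡.refl
  ... | false = ≡.refl

chromatic-words : ∀ N m → Slices._≋_ N (chromatic (cycle (suc m))) (Words.Σ[_] T[ N ] t (colourings N (suc m)) (weight N))
-- Matching on the length identifies `N` with `length α`, the number of colours that `chromatic`
-- uses at `α`.
chromatic-words N m j = on λ { α ≡.refl →
  ≡.trans (count-filter _ (colourings (length α) (suc m))) (sums α (colourings (length α) (suc m))) }
  where
  sums : ∀ α xs → foldr (λ κ s →
           (if does (proper? (cycle (suc m)) κ ×-dec asc (cycle (suc m)) κ ≟ j ×-dec ≡-dec _≟_ (content κ) α)
            then 1ℤ else 0ℤ) ℤ.+ s) 0ℤ xs
         ≡ Words.Σ[_] T[ length α ] t xs (weight (length α)) j α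
  sums α []       = ≡.refl
  sums α (κ ∷ xs) = ≡.cong₂ ℤ._+_ (weight-coeff m j α κ) (sums α xs)

chromatic-trace : ∀ N m → Slices._≋_ N (chromatic (cycle (suc m))) (ClosedWalks.trace T[ N ] t (xᵀ N) (suc m))
chromatic-trace N m = TR.trans N (chromatic-words N m) (TR.sym N (Words.sum-closed T[ N ] t (xᵀ N) m))

-- Closed walks also have a term of length 1, which the sum over n ≥ 2 lacks; it is zero because `M`
-- has zero diagonal.
trace-1 : ∀ N → Slices._≋_ N (ClosedWalks.trace T[ N ] t (xᵀ N) 1) T.0#
trace-1 N = TR.trans N (sum-cong-≋ (Words.M-unit-diagonal T[ N ] t (xᵀ N))) (sum-replicate-zero N)
  where open MonoidSum (TR.+-monoid N) using (sum-cong-≋; sum-replicate-zero)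

e-xᵀ : ∀ N k → Slices._≋_ N (Transfer.e⟨_⟩ T[ N ] t k (xᵀ N)) (T-series.const (e k))
e-xᵀ N k = TR.trans N (const-e k xvar) λ { zero → e-xvar N k ; (suc j) → R.refl N }
  where
  const-e : ∀ {n} k (x : Vector X.Carrier n) →
            Slices._≋_ N (Transfer.e⟨_⟩ T[ N ] t k (T-series.const ∘ x)) (T-series.const (eX.e⟨_⟩ N k x))
  const-e         zero    x = λ { zero → R.refl N ; (suc j) → R.refl N }
  const-e {zero}  (suc k) x = λ { zero → R.refl N ; (suc j) → R.refl N }
  const-e {suc n} (suc k) x = TR.trans N
    (TR.+-cong N (const-e (suc k) (tail x)) (TR.*-cong N (TR.refl N {T-series.const (x zero)}) (const-e k (tail x))))
    λ { zero    → R.+-cong N (R.refl N {eX.e⟨_⟩ N (suc k) (tail x)}) (Slices.const-⊛ N (x zero) e′ 0)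
      ; (suc j) → R.trans N (R.+-cong N (R.refl N {X.0#})
          (R.trans N (Slices.const-⊛ N (x zero) e′ (suc j)) (R.zeroʳ N (x zero)))) (R.+-identityˡ N X.0#) }
    where e′ = T-series.const (eX.e⟨_⟩ N k (tail x))

-- The generating function of the directed cycles

module XC = CommutativeRing ℤ⟦x⟧-commutativeRing
module TX = PowerSeriesProperties ℤ⟦x⟧-commutativeRing
module TC = CommutativeRing TX.commutativeRing
module ZX = PowerSeriesProperties TX.commutativeRing
module ZC = CommutativeRing ZX.commutativeRing

cycles : Z.Carrier
cycles = Z-series.Σ≥2 (λ n → chromatic (cycle n))

numeratorᶻ : Z.Carrier
numeratorᶻ = Z-series.const t Z.* Z-series.Σ≥2 (λ k → (k T.· [ k ∸ 1 ]ₜ) T.* T-series.const (e k))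

kernelᶻ : Z.Carrier
kernelᶻ = Z-series.const t Z.* Z-series.Σ≥2 (λ k → [ k ∸ 1 ]ₜ T.* T-series.const (e k))

denominatorᶻ : Z.Carrier
denominatorᶻ = Z.1# Z.+ (Z.- kernelᶻ)

module _ (N : ℕ) where
  open TR N hiding (zero)
  open ClosedWalks T[ N ] t
  open Transfer T[ N ] t using (e⟨_⟩; sum; _·_)
  open RawSemiringDefs (RawRing.rawSemiring rawRing) using (_^_)
  open SemiringMult semiring using (×-assoc-*; ×-comm-*; ×-congʳ)
  open RingProperties ring using (-0#≈0#)
  open PowerSeriesProperties T[ N ] using (const-⊛)
  open SetoidReasoning setoid
  private x = xᵀ N

  -- The two units are instances of `const` over different raw rings, so they agree only after a
  -- split on the exponent of t.
  1≈ : T.1# ≈ 1#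
  1≈ zero    = R.refl N
  1≈ (suc j) = R.refl N

  ^≈ : ∀ m → t T.^ m ≈ t ^ m
  ^≈ zero    = 1≈
  ^≈ (suc m) = *-congˡ {t} (^≈ m)

  ×≈ : ∀ m y → m T.· y ≈ m · y
  ×≈ zero    y = refl
  ×≈ (suc m) y = +-congˡ {y} (×≈ m y)

  sum≈ : ∀ {m} {f g : Fin m → T.Carrier} → (∀ i → f i ≈ g i) → T.sum f ≈ sum g
  sum≈ {zero}  p = refl
  sum≈ {suc m} p = +-cong (p zero) (sum≈ (p ∘ suc))

  bracket≈ : ∀ k → [ k ]ₜ ≈ ⟦ k ⟧
  bracket≈ k = sum≈ {k} (λ i → ^≈ (toℕ i))

  denominator≈ : ∀ n → denominatorᶻ n ≈ denominator x n
  denominator≈ n = trans (+-congˡ {Z.1# n} (-‿cong (const-⊛ t (Z-series.Σ≥2 (λ k → [ k ∸ 1 ]ₜ T.* T-series.const (e k))) n))) (rest n)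
    where
    rest : ∀ n → Z.1# n + (- (t * Z-series.Σ≥2 (λ k → [ k ∸ 1 ]ₜ T.* T-series.const (e k)) n)) ≈ denominator x n
    rest 0 = trans (+-cong 1≈ (trans (-‿cong (zeroʳ t)) -0#≈0#)) (+-identityʳ 1#)
    rest 1 = trans (+-identityˡ (- (t * 0#))) (-‿cong (*-congˡ {t} (sym (zeroˡ _))))
    rest (suc (suc k)) = trans (+-identityˡ _) (-‿cong (*-congˡ {t} (*-cong (bracket≈ (suc k)) (sym (e-xᵀ N (suc (suc k)))))))

  numerator≈ : ∀ n → numeratorᶻ n ≈ numerator x n
  numerator≈ n = trans (const-⊛ t (Z-series.Σ≥2 (λ k → (k T.· [ k ∸ 1 ]ₜ) T.* T-series.const (e k))) n) (rest n)
    where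
    rest : ∀ n → t * Z-series.Σ≥2 (λ k → (k T.· [ k ∸ 1 ]ₜ) T.* T-series.const (e k)) n ≈ numerator x n
    rest 0 = zeroʳ t
    rest 1 = *-congˡ {t} (sym (zeroˡ _))
    rest (suc (suc k)) = *-congˡ {t} (begin
      (suc (suc k) T.· [ suc k ]ₜ) * T-series.const (e (suc (suc k)))
        ≈⟨ *-cong (trans (×≈ (suc (suc k)) [ suc k ]ₜ) (×-congʳ (suc (suc k)) (bracket≈ (suc k)))) (sym (e-xᵀ N (suc (suc k)))) ⟩
      (suc (suc k) · ⟦ suc k ⟧) * ek
        ≈⟨ ×-assoc-* (suc (suc k)) ⟦ suc k ⟧ ek ⟩
      suc (suc k) · (⟦ suc k ⟧ * ek)
        ≈⟨ ×-comm-* (suc (suc k)) ⟦ suc k ⟧ ek ⟨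
      ⟦ suc k ⟧ * (suc (suc k) · ek) ∎)
      where ek = e⟨ suc (suc k) ⟩ x

  cycles≈ : ∀ n → cycles n ≈ trace x n
  cycles≈ 0             = sym (MonoidSum.sum-replicate-zero +-monoid N)
  cycles≈ 1             = sym (trace-1 N)
  cycles≈ (suc (suc m)) = chromatic-trace N (suc m)

-- Both sides at `α` are computed with `length α` variables, where the identity is that of the trace
-- of closed walks.
denominator*cycles : denominatorᶻ Z.* cycles Z.≈ numeratorᶻ
denominator*cycles n j α = at (coefficient n j) α ≡.refl
  where
  N = length α
  open TR N
  open PowerSeriesProperties T[ N ] using (⊛-cong)
  coefficient : ∀ n → (denominatorᶻ Z.* cycles) n ≈ numeratorᶻ n
  coefficient n = trans (⊛-cong (denominator≈ N) (cycles≈ N) n)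
    (trans (ClosedWalks.denominator-trace T[ N ] t (xᵀ N) n) (sym (numerator≈ N n)))

kernel₀ : kernelᶻ 0 T.≈ T.0#
kernel₀ = TC.trans (ZX.const-⊛ t (Z-series.Σ≥2 (λ k → [ k ∸ 1 ]ₜ T.* T-series.const (e k))) 0) (TC.zeroʳ t)

generating-function : cycles ≈ numeratorᶻ / denominatorᶻ
generating-function = B⁻¹ , B*B⁻¹ , (begin
  cycles                                    ≈⟨ ZC.*-identityʳ cycles ⟨
  cycles Z.* Z.1#                           ≈⟨ ZC.*-congˡ {cycles} B*B⁻¹ ⟨
  cycles Z.* (denominatorᶻ Z.* B⁻¹)         ≈⟨ ZC.*-assoc cycles denominatorᶻ B⁻¹ ⟨
  cycles Z.* denominatorᶻ Z.* B⁻¹           ≈⟨ ZC.*-congʳ {B⁻¹} (ZC.*-comm cycles denominatorᶻ) ⟩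
  denominatorᶻ Z.* cycles Z.* B⁻¹           ≈⟨ ZC.*-congʳ {B⁻¹} denominator*cycles ⟩
  numeratorᶻ Z.* B⁻¹                        ∎)
  where
  open SetoidReasoning ZC.setoid
  open RingProperties TC.ring using (-0#≈0#)
  inverse : _
  inverse = ZX.inverse denominatorᶻ (TC.trans (TC.+-congˡ {T.1#} (TC.trans (TC.-‿cong kernel₀) -0#≈0#)) (TC.+-identityʳ T.1#))
  B⁻¹   = proj₁ inverse
  B*B⁻¹ = proj₂ inverse

-- The form without subtraction, in which positivity can be passed on by induction.
recurrence : cycles Z.≈ numeratorᶻ Z.+ kernelᶻ Z.* cycles
recurrence = begin
  cycles ≈⟨ ZC.+-identityʳ cycles ⟨
  cycles Z.+ Z.0# ≈⟨ ZC.+-congˡ {cycles} (ZC.-‿inverseˡ kc) ⟨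
  cycles Z.+ ((Z.- kc) Z.+ kc) ≈⟨ ZC.+-assoc cycles (Z.- kc) kc ⟨
  cycles Z.+ (Z.- kc) Z.+ kc ≈⟨ ZC.+-congʳ {kc} (ZC.+-cong (ZC.*-identityˡ cycles) (ZC.sym (-‿distribˡ-* kernelᶻ cycles))) ⟨
  Z.1# Z.* cycles Z.+ (Z.- kernelᶻ) Z.* cycles Z.+ kc ≈⟨ ZC.+-congʳ {kc} (ZC.distribʳ cycles Z.1# (Z.- kernelᶻ)) ⟨
  denominatorᶻ Z.* cycles Z.+ kc ≈⟨ ZC.+-congʳ {kc} denominator*cycles ⟩
  numeratorᶻ Z.+ kc ∎
  where
  open SetoidReasoning ZC.setoid
  open RingProperties ZC.ring using (-‿distribˡ-*)
  kc = kernelᶻ Z.* cycles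

-- e-positivity

scale : ℤ → X.Carrier → X.Carrier
scale c f α = c ℤ.* f α

Terms : Set
Terms = List (ℤ × List ℕ)

-- Merges the coefficients of equal partitions, because an expansion must list distinct ones.
addTerm : ℤ → List ℕ → Terms → Terms
addTerm c μ []             = (c , μ) ∷ []
addTerm c μ ((d , ν) ∷ ts) with ≡-dec _≟_ μ ν
... | yes _ = (c ℤ.+ d , ν) ∷ ts
... | no  _ = (d , ν) ∷ addTerm c μ ts

addTerm-expansion : ∀ c μ ts → e-combination (addTerm c μ ts) X.≈ scale c e[ μ ] X.+ e-combination ts
addTerm-expansion c μ []             α = ≡.refl
addTerm-expansion c μ ((d , ν) ∷ ts) with ≡-dec _≟_ μ ν
... | yes ≡.refl = λ α → ≡.trans (≡.cong (ℤ._+ e-combination ts α) (ℤₚ.*-distribʳ-+ (e[ ν ] α) c d))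
                                 (ℤₚ.+-assoc (c ℤ.* e[ ν ] α) (d ℤ.* e[ ν ] α) (e-combination ts α))
... | no  _      = λ α → ≡.trans (≡.cong (λ s → d ℤ.* e[ ν ] α ℤ.+ s) (addTerm-expansion c μ ts α))
    (let p = d ℤ.* e[ ν ] α ; q = c ℤ.* e[ μ ] α ; r = e-combination ts α in
     ≡.trans (≡.sym (ℤₚ.+-assoc p q r)) (≡.trans (≡.cong (ℤ._+ r) (ℤₚ.+-comm p q)) (ℤₚ.+-assoc q p r)))

module _ {p} {P : List ℕ → Set p} where
  addTerm-partitions : ∀ c μ ts → P μ → All (λ (_ , ν) → P ν) ts → All (λ (_ , ν) → P ν) (addTerm c μ ts)
  addTerm-partitions c μ []             pμ []         = pμ ∷ []
  addTerm-partitions c μ ((d , ν) ∷ ts) pμ (pν ∷ pts) with ≡-dec _≟_ μ ν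
  ... | yes _ = pν ∷ pts
  ... | no  _ = pν ∷ addTerm-partitions c μ ts pμ pts

addTerm-nonnegative : ∀ c μ ts → 0ℤ ℤ.≤ c → All (λ (d , _) → 0ℤ ℤ.≤ d) ts → All (λ (d , _) → 0ℤ ℤ.≤ d) (addTerm c μ ts)
addTerm-nonnegative c μ []             0≤c []         = 0≤c ∷ []
addTerm-nonnegative c μ ((d , ν) ∷ ts) 0≤c (0≤d ∷ ps) with ≡-dec _≟_ μ ν
... | yes _ = ℤₚ.+-mono-≤ 0≤c 0≤d ∷ ps
... | no  _ = 0≤d ∷ addTerm-nonnegative c μ ts 0≤c ps

addTerm-fresh : ∀ c μ ν ts → ν ≢ μ → All (ν ≢_) (map proj₂ ts) → All (ν ≢_) (map proj₂ (addTerm c μ ts))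
addTerm-fresh c μ ν []              ν≢μ []       = ν≢μ ∷ []
addTerm-fresh c μ ν ((d , ν′) ∷ ts) ν≢μ (p ∷ ps) with ≡-dec _≟_ μ ν′
... | yes _ = p ∷ ps
... | no  _ = p ∷ addTerm-fresh c μ ν ts ν≢μ ps

addTerm-distinct : ∀ c μ ts → Unique (map proj₂ ts) → Unique (map proj₂ (addTerm c μ ts))
addTerm-distinct c μ []             []       = [] ∷ []
addTerm-distinct c μ ((d , ν) ∷ ts) (p ∷ ps) with ≡-dec _≟_ μ ν
... | yes _   = p ∷ ps
... | no  μ≢ν = addTerm-fresh c μ ν ts (μ≢ν ∘ ≡.sym) p ∷ addTerm-distinct c μ ts ps

EPositive-resp : ∀ {f g} → f X.≈ g → EPositive f → EPositive g
EPositive-resp f≈g (ts , ex , nn) = ts , record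
  { partitions = partitions ; distinct = distinct ; expansion = λ α → ≡.trans (≡.sym (f≈g α)) (expansion α) } , nn
  where open IsEExpansion ex

EPositive-0 : EPositive X.0#
EPositive-0 = [] , record { partitions = [] ; distinct = [] ; expansion = λ _ → ≡.refl } , []

EPositive-addTerm : ∀ {f} c μ → 0ℤ ℤ.≤ c → IsPartition μ → EPositive f → EPositive (scale c e[ μ ] X.+ f)
EPositive-addTerm c μ 0≤c pμ (ts , ex , nn) = addTerm c μ ts , record
  { partitions = addTerm-partitions c μ ts pμ partitions
  ; distinct   = addTerm-distinct c μ ts distinct
  ; expansion  = λ α → ≡.trans (≡.cong (λ s → c ℤ.* e[ μ ] α ℤ.+ s) (expansion α)) (≡.sym (addTerm-expansion c μ ts α))
  } , addTerm-nonnegative c μ ts 0≤c nn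
  where open IsEExpansion ex

EPositive-+ : ∀ {f g} → EPositive f → EPositive g → EPositive (f X.+ g)
EPositive-+ {f} {g} (ts , ex , nn) pg =
  EPositive-resp (λ α → ≡.cong (ℤ._+ g α) (≡.sym (expansion α))) (go ts partitions nn)
  where
  open IsEExpansion ex
  go : ∀ ts → All (λ (_ , μ) → IsPartition μ) ts → All (λ (c , _) → 0ℤ ℤ.≤ c) ts → EPositive (e-combination ts X.+ g)
  go []             []       []         = EPositive-resp (λ α → ≡.sym (ℤₚ.+-identityˡ (g α))) pg
  go ((c , μ) ∷ ts) (p ∷ ps) (0≤c ∷ qs) = EPositive-resp
    (λ α → ≡.sym (ℤₚ.+-assoc (c ℤ.* e[ μ ] α) (e-combination ts α) (g α)))
    (EPositive-addTerm c μ 0≤c p (go ts ps qs))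

e[]-↭ : ∀ {μ ν} → μ ↭.↭ ν → e[ μ ] X.≈ e[ ν ]
e[]-↭ ↭.refl = λ _ → ≡.refl
e[]-↭ (↭.prep k p) = XC.*-congˡ {e k} (e[]-↭ p)
e[]-↭ (↭.swap {μ} {ν} k l p) = begin
  e k X.* (e l X.* e[ μ ]) ≈⟨ XC.*-assoc (e k) (e l) e[ μ ] ⟨
  (e k X.* e l) X.* e[ μ ] ≈⟨ XC.*-cong (XC.*-comm (e k) (e l)) (e[]-↭ p) ⟩
  (e l X.* e k) X.* e[ ν ] ≈⟨ XC.*-assoc (e l) (e k) e[ ν ] ⟩
  e l X.* (e k X.* e[ ν ]) ∎
  where open SetoidReasoning XC.setoid
e[]-↭ (↭.trans p q) = XC.trans (e[]-↭ p) (e[]-↭ q)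

-- The recurrence yields the factors of a product in no particular order. Sorting for the flipped
-- order makes the list weakly decreasing, and commutativity keeps the product.
EPositive-e[] : ∀ μ → All (0 <_) μ → EPositive e[ μ ]
EPositive-e[] μ positive = EPositive-resp
  (λ α → ≡.trans (ℤₚ.+-identityʳ _) (≡.trans (ℤₚ.*-identityˡ _) (e[]-↭ (sort-↭ μ) α)))
  (EPositive-addTerm 1ℤ (sort μ) (ℤ.+≤+ z≤n) (All-resp-↭ (↭.↭-sym (sort-↭ μ)) positive , sort-↗ μ) EPositive-0)
  where open Sort (Flip.decTotalOrder ℕₚ.≤-decTotalOrder)

-- Intervals of exponents symmetric about n / 2

window : ℕ → ℕ → ℕ → Bool
window zero    zero    j       = false
window zero    (suc b) zero    = true
window zero    (suc b) (suc j) = window zero b j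
window (suc a) b       zero    = false
window (suc a) b       (suc j) = window a b j

window-true : ∀ a b j → a ≤ j → j < a ℕ.+ b → window a b j ≡ true
window-true zero    (suc b) zero    _       _       = ≡.refl
window-true zero    (suc b) (suc j) _       (s≤s q) = window-true zero b j z≤n q
window-true (suc a) b       (suc j) (s≤s p) (s≤s q) = window-true a b j p q

window-bounds : ∀ a b j → window a b j ≡ true → a ≤ j × j < a ℕ.+ b
window-bounds zero    (suc b) zero    _  = z≤n , s≤s z≤n
window-bounds zero    (suc b) (suc j) eq = z≤n , s≤s (proj₂ (window-bounds zero b j eq))
window-bounds (suc a) b       (suc j) eq = let p , q = window-bounds a b j eq in s≤s p , s≤s q

window-reflect : ∀ a b n j → a ℕ.+ (a ℕ.+ b) ≡ suc n → j ≤ n → window a b j ≡ true → window a b (n ∸ j) ≡ true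
window-reflect a b n j eq j≤n h = window-true a b (n ∸ j)
  (ℕₚ.m+n≤o⇒m≤o∸n a (ℕₚ.≤-pred (begin
    suc (a ℕ.+ j)       ≡⟨ ℕₚ.+-suc a j ⟨
    a ℕ.+ suc j         ≤⟨ ℕₚ.+-monoʳ-≤ a j<a+b ⟩
    a ℕ.+ (a ℕ.+ b)     ≡⟨ eq ⟩
    suc n               ∎)))
  (ℕₚ.+-cancelʳ-< j (n ∸ j) (a ℕ.+ b) (begin
    suc (n ∸ j ℕ.+ j)   ≡⟨ ≡.cong suc (ℕₚ.m∸n+n≡m j≤n) ⟩
    suc n               ≡⟨ eq ⟨
    a ℕ.+ (a ℕ.+ b)     ≤⟨ ℕₚ.+-monoˡ-≤ (a ℕ.+ b) a≤j ⟩
    j ℕ.+ (a ℕ.+ b)     ≡⟨ ℕₚ.+-comm j (a ℕ.+ b) ⟩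
    a ℕ.+ b ℕ.+ j       ∎))
  where
  open ℕₚ.≤-Reasoning
  a≤j   = proj₁ (window-bounds a b j h)
  j<a+b = proj₂ (window-bounds a b j h)

window-palindromic : ∀ a b n j → a ℕ.+ (a ℕ.+ b) ≡ suc n → j ≤ n → window a b j ≡ window a b (n ∸ j)
window-palindromic a b n j eq j≤n = iff (window-reflect a b n j eq j≤n)
  (λ h → ≡.subst (λ i → window a b i ≡ true) (ℕₚ.m∸[m∸n]≡n j≤n) (window-reflect a b n (n ∸ j) eq (ℕₚ.m∸n≤m n j) h))
  where
  iff : ∀ {x y} → (x ≡ true → y ≡ true) → (y ≡ true → x ≡ true) → x ≡ y
  iff {true}          f g = ≡.sym (f ≡.refl)
  iff {false} {true}  f g = g ≡.refl
  iff {false} {false} f g = ≡.refl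

-- A window that contains `j` but not `suc j` has last element `j` and first element at most `j`;
-- being centred at n / 2, it forces n ≤ 2j.
window-increasing : ∀ a b n j → a ℕ.+ (a ℕ.+ b) ≡ suc n → 2 ℕ.* j < n ∸ 1 → window a b j ≡ true → window a b (suc j) ≡ true
window-increasing a b (suc n) j eq 2j<n h = window-true a b (suc j) (ℕₚ.m≤n⇒m≤1+n a≤j) (ℕₚ.≰⇒> λ a+b≤1+j →
  ℕₚ.<-irrefl ≡.refl (begin-strict
    2 ℕ.* j           <⟨ 2j<n ⟩
    n                 ≤⟨ ℕₚ.≤-pred (ℕₚ.≤-pred (begin
      suc (suc n)     ≡⟨ eq ⟨
      a ℕ.+ (a ℕ.+ b) ≤⟨ ℕₚ.+-mono-≤ a≤j a+b≤1+j ⟩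
      j ℕ.+ suc j     ≤⟨ ℕₚ.n≤1+n _ ⟩
      suc (j ℕ.+ suc j) ≡⟨ ≡.cong suc (ℕₚ.+-suc j j) ⟩
      suc (suc (j ℕ.+ j)) ∎)) ⟩
    j ℕ.+ j           ≡⟨ ≡.cong (j ℕ.+_) (ℕₚ.+-identityʳ j) ⟨
    2 ℕ.* j           ∎))
  where
  open ℕₚ.≤-Reasoning
  a≤j = proj₁ (window-bounds a b j h)

-- Arithmetic of t-integers

[]-suc : ∀ k → [ suc k ]ₜ T.≈ T.1# T.+ t T.* [ k ]ₜ
[]-suc k = TC.+-congˡ {T.1#} (TC.sym (SemiringSum.*-distribˡ-sum TC.semiring {k} t (λ i → t T.^ toℕ i)))

[]-+ : ∀ m c → [ m ℕ.+ c ]ₜ T.≈ [ m ]ₜ T.+ t T.^ m T.* [ c ]ₜ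
[]-+ zero    c = TC.sym (TC.trans (TC.+-identityˡ _) (TC.*-identityˡ [ c ]ₜ))
[]-+ (suc m) c = begin
  [ suc (m ℕ.+ c) ]ₜ                                    ≈⟨ []-suc (m ℕ.+ c) ⟩
  T.1# T.+ t T.* [ m ℕ.+ c ]ₜ                           ≈⟨ TC.+-congˡ {T.1#} (TC.*-congˡ {t} ([]-+ m c)) ⟩
  T.1# T.+ t T.* ([ m ]ₜ T.+ t T.^ m T.* [ c ]ₜ)
    ≈⟨ solve 5 (λ o t m p c → o :+ t :* (m :+ p :* c) := o :+ t :* m :+ t :* p :* c) TC.refl T.1# t [ m ]ₜ (t T.^ m) [ c ]ₜ ⟩
  T.1# T.+ t T.* [ m ]ₜ T.+ t T.^ suc m T.* [ c ]ₜ      ≈⟨ TC.+-congʳ {t T.^ suc m T.* [ c ]ₜ} ([]-suc m) ⟨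
  [ suc m ]ₜ T.+ t T.^ suc m T.* [ c ]ₜ                 ∎
  where
  open SetoidReasoning TC.setoid
  open SemiringSolver TC.commutativeSemiring using (solve; _:+_; _:*_; _:=_)

-- Palindromicity and unimodality

block : ℕ → ℕ → X.Carrier → T.Carrier
block a b f = t T.^ a T.* ([ b ]ₜ T.* T-series.const f)

block-coeff : ∀ a b f j → block a b f j X.≈ (if window a b j then f else X.0#)
block-coeff zero zero f j = XC.trans (TC.*-identityˡ ([ 0 ]ₜ T.* T-series.const f) j) (TC.zeroˡ (T-series.const f) j)
block-coeff zero (suc b) f j = XC.trans (unfold j) (by-index j)
  where
  open SetoidReasoning TC.setoid
  open SemiringSolver TC.commutativeSemiring using (solve; _:+_; _:*_; _:=_)
  unfold : block 0 (suc b) f T.≈ T-series.const f T.+ t T.* block 0 b f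
  unfold = begin
    T.1# T.* ([ suc b ]ₜ T.* T-series.const f) ≈⟨ TC.*-congˡ {T.1#} (TC.*-congʳ {T-series.const f} ([]-suc b)) ⟩
    T.1# T.* ((T.1# T.+ t T.* [ b ]ₜ) T.* T-series.const f)
      ≈⟨ solve 4 (λ o t b f → o :* ((o :+ t :* b) :* f) := o :* (o :* f) :+ t :* (o :* (b :* f))) TC.refl T.1# t [ b ]ₜ (T-series.const f) ⟩
    T.1# T.* (T.1# T.* T-series.const f) T.+ t T.* block 0 b f
      ≈⟨ TC.+-congʳ {t T.* block 0 b f} (TC.trans (TC.*-identityˡ (T.1# T.* T-series.const f)) (TC.*-identityˡ (T-series.const f))) ⟩
    T-series.const f T.+ t T.* block 0 b f ∎
  by-index : ∀ j → (T-series.const f T.+ t T.* block 0 b f) j X.≈ (if window 0 (suc b) j then f else X.0#)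
  by-index zero    = XC.trans (XC.+-congˡ {f} (TX.var-⊛-zero (block 0 b f))) (XC.+-identityʳ f)
  by-index (suc j) = XC.trans (XC.+-identityˡ _) (XC.trans (TX.var-⊛-suc (block 0 b f) j) (block-coeff 0 b f j))
block-coeff (suc a) b f j = XC.trans (TC.*-assoc t (t T.^ a) ([ b ]ₜ T.* T-series.const f) j) (by-index j)
  where
  by-index : ∀ j → (t T.* block a b f) j X.≈ (if window (suc a) b j then f else X.0#)
  by-index zero    = TX.var-⊛-zero (block a b f)
  by-index (suc j) = XC.trans (TX.var-⊛-suc (block a b f) j) (block-coeff a b f j)

-- [c+1][b+1] = [b+c+1] + t[c][b] writes a product of two t-integers as a sum
-- of shifted t-integers with a common centre.
[]-block : ∀ a b c f → [ suc c ]ₜ T.* block a (suc b) f T.≈ block a (suc b ℕ.+ c) f T.+ [ c ]ₜ T.* block (suc a) b f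
[]-block a b c f = begin
  [ suc c ]ₜ T.* (tᵃ T.* ([ suc b ]ₜ T.* F))
    ≈⟨ TC.*-congʳ {tᵃ T.* ([ suc b ]ₜ T.* F)} ([]-suc c) ⟩
  (T.1# T.+ t T.* [ c ]ₜ) T.* (tᵃ T.* ([ suc b ]ₜ T.* F))
    ≈⟨ solve 6 (λ o t c p b f → (o :+ t :* c) :* (p :* (b :* f)) := o :* (p :* (b :* f)) :+ t :* c :* p :* b :* f) TC.refl
         T.1# t [ c ]ₜ tᵃ [ suc b ]ₜ F ⟩
  T.1# T.* (tᵃ T.* ([ suc b ]ₜ T.* F)) T.+ t T.* [ c ]ₜ T.* tᵃ T.* [ suc b ]ₜ T.* F
    -- Only the second occurrence of `[ suc b ]ₜ` is split, as `[ b ]ₜ + tᵇ`: the part with `tᵇ`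
    -- prolongs the first occurrence to `[ suc b + c ]ₜ`, and the part with `[ b ]ₜ` is the
    -- remaining product.
    ≈⟨ TC.+-cong (TC.*-identityˡ (tᵃ T.* ([ suc b ]ₜ T.* F))) (TC.*-congʳ {F} (TC.*-congˡ {t T.* [ c ]ₜ T.* tᵃ} [suc-b])) ⟩
  tᵃ T.* ([ suc b ]ₜ T.* F) T.+ t T.* [ c ]ₜ T.* tᵃ T.* ([ b ]ₜ T.+ tᵇ) T.* F
    ≈⟨ solve 7 (λ t c p b q f s → p :* (s :* f) :+ t :* c :* p :* (b :+ q) :* f
                 := p :* ((s :+ t :* q :* c) :* f) :+ c :* (t :* p :* (b :* f))) TC.refl
         t [ c ]ₜ tᵃ [ b ]ₜ tᵇ F [ suc b ]ₜ ⟩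
  tᵃ T.* (([ suc b ]ₜ T.+ t T.^ suc b T.* [ c ]ₜ) T.* F) T.+ [ c ]ₜ T.* block (suc a) b f
    ≈⟨ TC.+-congʳ {[ c ]ₜ T.* block (suc a) b f} (TC.*-congˡ {tᵃ} (TC.*-congʳ {F} ([]-+ (suc b) c))) ⟨
  block a (suc b ℕ.+ c) f T.+ [ c ]ₜ T.* block (suc a) b f ∎
  where
  open SetoidReasoning TC.setoid
  open SemiringSolver TC.commutativeSemiring using (solve; _:+_; _:*_; _:=_)
  F  = T-series.const f
  tᵃ = t T.^ a
  tᵇ = t T.^ b
  [suc-b] : [ suc b ]ₜ T.≈ [ b ]ₜ T.+ tᵇ
  [suc-b] = begin
    [ suc b ]ₜ                          ≡⟨ ≡.cong [_]ₜ (ℕₚ.+-comm 1 b) ⟩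
    [ b ℕ.+ 1 ]ₜ                        ≈⟨ []-+ b 1 ⟩
    [ b ]ₜ T.+ tᵇ T.* (T.1# T.+ T.0#)   ≈⟨ TC.+-congˡ {[ b ]ₜ} (TC.trans (TC.*-congˡ {tᵇ} (TC.+-identityʳ T.1#)) (TC.*-identityʳ tᵇ)) ⟩
    [ b ]ₜ T.+ tᵇ                       ∎

-- Sums of terms tᵃ [b]ₜ e_μ whose coefficients are centred at n / 2.
data Centred (n : ℕ) : T.Carrier → Set where
  null  : Centred n T.0#
  basic : ∀ a b {μ} → All (0 <_) μ → a ℕ.+ (a ℕ.+ b) ≡ suc n → Centred n (block a b e[ μ ])
  _⊞_   : ∀ {f g} → Centred n f → Centred n g → Centred n (f T.+ g)
  resp  : ∀ {f g} → f T.≈ g → Centred n f → Centred n g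

-- A Clebsch-Gordan decomposition: each use of `[]-block` splits off one block and lowers `b` and
-- `c` while `a` grows, so the centre stays fixed. A factor `[ c ]ₜ` has top exponent `c − 1`, hence
-- `2 + n` where a single block has `suc n`.
centred-[] : ∀ {n μ} a b c → All (0 <_) μ → a ℕ.+ (a ℕ.+ b) ℕ.+ c ≡ 2 ℕ.+ n → Centred n ([ c ]ₜ T.* block a b e[ μ ])
centred-[] {μ = μ} a b       zero    pos eq = resp (TC.sym (TC.zeroˡ (block a b e[ μ ]))) null
centred-[] {μ = μ} a zero    (suc c) pos eq = resp (TC.sym (TC.trans
  (TC.*-congˡ {[ suc c ]ₜ} (TC.trans (TC.*-congˡ {t T.^ a} (TC.zeroˡ (T-series.const e[ μ ]))) (TC.zeroʳ (t T.^ a)))) (TC.zeroʳ [ suc c ]ₜ))) null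
centred-[] {n} {μ} a (suc b) (suc c) pos eq = resp (TC.sym ([]-block a b c e[ μ ]))
  (basic a (suc b ℕ.+ c) pos (ℕₚ.suc-injective (≡.trans (lemma₁ a b c) eq))
    ⊞ centred-[] (suc a) b c pos (≡.trans (lemma₂ a b c) eq))
  where
  lemma₁ : ∀ a b c → suc (a ℕ.+ (a ℕ.+ (suc b ℕ.+ c))) ≡ a ℕ.+ (a ℕ.+ suc b) ℕ.+ suc c
  lemma₁ = solve-∀ℕ
  lemma₂ : ∀ a b c → suc a ℕ.+ (suc a ℕ.+ b) ℕ.+ c ≡ a ℕ.+ (a ℕ.+ suc b) ℕ.+ suc c
  lemma₂ = solve-∀ℕ

const-* : ∀ f g → T-series.const f T.* T-series.const g T.≈ T-series.const (f X.* g)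
const-* f g zero    = TX.const-⊛ f (T-series.const g) 0
const-* f g (suc j) = XC.trans (TX.const-⊛ f (T-series.const g) (suc j)) (XC.zeroʳ f)

kernelTerm : ℕ → T.Carrier
kernelTerm k = t T.* ([ k ∸ 1 ]ₜ T.* T-series.const (e k))

-- The exponents of t in the kernel term run from 1 to `suc k`, so it is centred at half of `2 + k`;
-- centres add under multiplication.
centred-kernel : ∀ {n f} k → Centred n f → Centred (2 ℕ.+ k ℕ.+ n) (kernelTerm (2 ℕ.+ k) T.* f)
centred-kernel k null = resp (TC.sym (TC.zeroʳ (kernelTerm (2 ℕ.+ k)))) null
centred-kernel {n} k (basic a b {μ} pos eq) = resp (TC.sym (begin
  (t T.* ([ suc k ]ₜ T.* F)) T.* (t T.^ a T.* ([ b ]ₜ T.* G))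
    ≈⟨ solve 6 (λ t k f p b g → (t :* (k :* f)) :* (p :* (b :* g)) := k :* (t :* p :* (b :* (f :* g)))) TC.refl
         t [ suc k ]ₜ F (t T.^ a) [ b ]ₜ G ⟩
  [ suc k ]ₜ T.* (t T.^ suc a T.* ([ b ]ₜ T.* (F T.* G)))
    ≈⟨ TC.*-congˡ {[ suc k ]ₜ} (TC.*-congˡ {t T.^ suc a} (TC.*-congˡ {[ b ]ₜ} (const-* (e (2 ℕ.+ k)) e[ μ ]))) ⟩
  [ suc k ]ₜ T.* block (suc a) b e[ (2 ℕ.+ k) ∷ μ ] ∎))
  (centred-[] (suc a) b (suc k) (s≤s z≤n ∷ pos) (≡.trans (lemma₁ a b k) (≡.trans (≡.cong (λ s → s ℕ.+ (3 ℕ.+ k)) eq) (lemma₂ n k))))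
  where
  open SetoidReasoning TC.setoid
  open SemiringSolver TC.commutativeSemiring using (solve; _:+_; _:*_; _:=_)
  F = T-series.const (e (2 ℕ.+ k))
  G = T-series.const e[ μ ]
  lemma₁ : ∀ a b k → suc a ℕ.+ (suc a ℕ.+ b) ℕ.+ suc k ≡ a ℕ.+ (a ℕ.+ b) ℕ.+ (3 ℕ.+ k)
  lemma₁ = solve-∀ℕ
  lemma₂ : ∀ n k → suc n ℕ.+ (3 ℕ.+ k) ≡ 2 ℕ.+ (2 ℕ.+ k ℕ.+ n)
  lemma₂ = solve-∀ℕ
centred-kernel k (_⊞_ {f} {g} p q) = resp (TC.sym (TC.distribˡ (kernelTerm (2 ℕ.+ k)) f g)) (centred-kernel k p ⊞ centred-kernel k q)
centred-kernel k (resp f≈g p)      = resp (TC.*-congˡ {kernelTerm (2 ℕ.+ k)} f≈g) (centred-kernel k p)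

centred-× : ∀ {n f} k → Centred n f → Centred n (k T.· f)
centred-× zero    p = null
centred-× (suc k) p = p ⊞ centred-× k p

centred-sum : ∀ {n m} (f : Fin m → T.Carrier) → (∀ i → Centred n (f i)) → Centred n (T.sum f)
centred-sum {m = zero}  f p = null
centred-sum {m = suc m} f p = p zero ⊞ centred-sum (f ∘ suc) (p ∘ suc)

centred-numerator : ∀ n → Centred n (numeratorᶻ n)
centred-numerator m = resp (TC.sym (ZX.const-⊛ t (Z-series.Σ≥2 coeff) m)) (by-index m)
  where
  coeff : ℕ → T.Carrier
  coeff k = (k T.· [ k ∸ 1 ]ₜ) T.* T-series.const (e k)
  open SetoidReasoning TC.setoid
  open SemiringMult TC.semiring using (×-assoc-*; ×-comm-*; ×-congʳ)
  open SemiringSolver TC.commutativeSemiring using (solve; _:+_; _:*_; _:=_)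
  by-index : ∀ n → Centred n (t T.* Z-series.Σ≥2 coeff n)
  by-index 0 = resp (TC.sym (TC.zeroʳ t)) null
  by-index 1 = resp (TC.sym (TC.zeroʳ t)) null
  by-index (suc (suc k)) = resp (TC.sym (begin
    t T.* ((n T.· B) T.* F)                    ≈⟨ TC.*-congˡ {t} (×-assoc-* n B F) ⟩
    t T.* (n T.· (B T.* F))                    ≈⟨ ×-comm-* n t (B T.* F) ⟩
    n T.· (t T.* (B T.* F))                    ≈⟨ ×-congʳ n (TC.*-cong (TC.sym (TC.*-identityʳ t)) (TC.*-congˡ {B} F≈)) ⟩
    n T.· block 1 (suc k) e[ n ∷ [] ]          ∎))
    -- The exponents of t [n-1]_t run from 1 to n - 1, symmetric about n / 2.
    (centred-× n (basic 1 (suc k) (s≤s z≤n ∷ []) ≡.refl))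
    where
    n = suc (suc k)
    B = [ suc k ]ₜ
    F = T-series.const (e n)
    F≈ : F T.≈ T-series.const e[ n ∷ [] ]
    F≈ zero    = XC.sym (XC.*-identityʳ (e n))
    F≈ (suc j) = XC.refl {X.0#}

centred-cycles : ∀ n → Centred n (cycles n)
centred-cycles = <-rec (λ n → Centred n (cycles n)) step
  where
  step : ∀ n → (∀ {m} → m < n → Centred m (cycles m)) → Centred n (cycles n)
  step n ih = resp (TC.sym (recurrence n))
    (centred-numerator n ⊞ centred-sum (λ i → kernelᶻ (toℕ i) T.* cycles (n ∸ toℕ i)) λ i →
      resp (TC.*-congʳ {cycles (n ∸ toℕ i)} (TC.sym (ZX.const-⊛ t (Z-series.Σ≥2 coeff) (toℕ i)))) (term (toℕ i) (ℕₚ.≤-pred (toℕ<n i))))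
    where
    coeff : ℕ → T.Carrier
    coeff k = [ k ∸ 1 ]ₜ T.* T-series.const (e k)
    vanish : ∀ f → Centred n ((t T.* T.0#) T.* f)
    vanish f = resp (TC.sym (TC.trans (TC.*-congʳ {f} (TC.zeroʳ t)) (TC.zeroˡ f))) null
    term : ∀ k → k ≤ n → Centred n ((t T.* Z-series.Σ≥2 coeff k) T.* cycles (n ∸ k))
    -- The term of index 0 would refer back to `cycles n`; it vanishes because the kernel starts at
    -- z², which makes the recursion well founded.
    term 0 k≤n = vanish (cycles n)
    term 1 k≤n = vanish (cycles (n ∸ 1))
    term (suc (suc k)) k≤n = ≡.subst (λ m → Centred m (kernelTerm (2 ℕ.+ k) T.* cycles (n ∸ (2 ℕ.+ k))))
      (ℕₚ.m+[n∸m]≡n k≤n) (centred-kernel k (ih (ℕₚ.∸-monoʳ-< {n} {2 ℕ.+ k} {0} (s≤s z≤n) k≤n)))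

if-cong : ∀ {x y} (f : X.Carrier) → x ≡ y → (if x then f else X.0#) X.≈ (if y then f else X.0#)
if-cong f ≡.refl = XC.refl

centred⇒palindromic : ∀ {n f} → Centred n f → ∀ j → j ≤ n → f j X.≈ f (n ∸ j)
centred⇒palindromic null j j≤n = XC.refl {X.0#}
centred⇒palindromic {n} (basic a b {μ} _ eq) j j≤n = XC.trans (block-coeff a b e[ μ ] j)
  (XC.trans (if-cong e[ μ ] (window-palindromic a b n j eq j≤n)) (XC.sym (block-coeff a b e[ μ ] (n ∸ j))))
centred⇒palindromic (p ⊞ q) j j≤n = XC.+-cong (centred⇒palindromic p j j≤n) (centred⇒palindromic q j j≤n)
centred⇒palindromic {n} (resp f≈g p) j j≤n = XC.trans (XC.sym (f≈g j)) (XC.trans (centred⇒palindromic p j j≤n) (f≈g (n ∸ j)))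

centred⇒EPositive : ∀ {n f} → Centred n f → ∀ j → EPositive (f j)
centred⇒EPositive null          j = EPositive-0
centred⇒EPositive (basic a b {μ} pos eq) j = EPositive-resp (XC.sym (block-coeff a b e[ μ ] j)) (cases (window a b j))
  where
  cases : ∀ d → EPositive (if d then e[ μ ] else X.0#)
  cases true  = EPositive-e[] μ pos
  cases false = EPositive-0
centred⇒EPositive (p ⊞ q)       j = EPositive-+ (centred⇒EPositive p j) (centred⇒EPositive q j)
centred⇒EPositive (resp f≈g p)  j = EPositive-resp (f≈g j) (centred⇒EPositive p j)

centred⇒unimodal : ∀ {n f} → Centred n f → ∀ j → 2 ℕ.* j < n ∸ 1 → EPositive (f (suc j) X.+ X.- f j)
centred⇒unimodal null j 2j<n = EPositive-0
centred⇒unimodal {n} (basic a b {μ} pos eq) j 2j<n = EPositive-resp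
  (XC.sym (XC.+-cong (block-coeff a b e[ μ ] (suc j)) (XC.-‿cong (block-coeff a b e[ μ ] j))))
  (cases (window a b (suc j)) (window a b j) (window-increasing a b n j eq 2j<n))
  where
  cases : ∀ x y → (y ≡ true → x ≡ true) → EPositive ((if x then e[ μ ] else X.0#) X.+ X.- (if y then e[ μ ] else X.0#))
  cases true  true  _ = EPositive-resp (XC.sym (XC.-‿inverseʳ e[ μ ])) EPositive-0
  cases true  false _ = EPositive-resp (XC.sym (XC.+-identityʳ e[ μ ])) (EPositive-e[] μ pos)
  cases false true  h = contradiction (h ≡.refl) λ ()
  cases false false _ = EPositive-0
centred⇒unimodal (_⊞_ {f} {g} p q) j 2j<n = EPositive-resp
  (λ α → rearrange (f (suc j) α) (f j α) (g (suc j) α) (g j α))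
  (EPositive-+ (centred⇒unimodal p j 2j<n) (centred⇒unimodal q j 2j<n))
  where
  rearrange : ∀ a b c d → (a ℤ.+ ℤ.- b) ℤ.+ (c ℤ.+ ℤ.- d) ≡ (a ℤ.+ c) ℤ.+ ℤ.- (b ℤ.+ d)
  rearrange = solve-∀ℤ
centred⇒unimodal (resp f≈g p) j 2j<n = EPositive-resp (XC.+-cong (f≈g (suc j)) (XC.-‿cong (f≈g j))) (centred⇒unimodal p j 2j<n)

theorem12 : (Z-series.Σ≥2 (λ n → chromatic (cycle n))
    ≈ (Z-series.const t Z.* Z-series.Σ≥2 (λ k → (k T.· [ k ∸ 1 ]ₜ) T.* T-series.const (e k)))
    / (Z.1# Z.+ (Z.- (Z-series.const t Z.* Z-series.Σ≥2 (λ k → [ k ∸ 1 ]ₜ T.* T-series.const (e k))))))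
    × (∀ (n : ℕ) → 2 ≤ n →
    ChromaticPalindromic (cycle n) × ChromaticEPositive (cycle n) × ChromaticEUnimodal (cycle n))
theorem12 = generating-function , λ { (suc (suc k)) (s≤s (s≤s z≤n)) →
  -- The three properties are centred by the length of the edge list, which equals the number of
  -- vertices only propositionally.
  let c = ≡.subst (λ m → Centred m (chromatic (cycle (2 ℕ.+ k))))
            (≡.sym (length-tabulate {n = 2 ℕ.+ k} (λ i → i , next i))) (centred-cycles (2 ℕ.+ k))
  in centred⇒palindromic c , centred⇒EPositive c , centred⇒unimodal c }
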